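{- Let $\bar Q$ be a gentle bound quiver with finitely many strings. Then the poset $\mathrm{Bicl}(\bar Q)$ of biclosed sets of undirected strings of $\bar Q$, ordered by inclusion, is a congruence-uniform lattice.
   Context: A gentle bound quiver is $\bar Q=(Q,I)$, $Q$ finite (paths composed left to right), $I$ admissible generated by length-two paths, each vertex with at most two incoming and two outgoing arrows, and for each arrow $\beta$ at most one $\alpha$ with $t(\alpha)=s(\beta),\alpha\beta\notin I$, at most one with $\alpha\beta\in I$, and dually at most one $\gamma$ with $s(\gamma)=t(\beta),\beta\gamma\notin I$ and at most one with $\beta\gamma\in I$. Strings: words $\alpha_1^{\epsilon_1}\cdots\alpha_\ell^{\epsilon_\ell}$ in arrows and formal inverses ($s(\alpha^{ -1})=t(\alpha)$, $t(\alpha^{ -1})=s(\alpha)$), composable, reduced, with no factor $\pi^{\pm1}$ for a path $\pi\in I$, or length-zero words $\varepsilon_v$; $\mathcal S^\pm(\bar Q)$ is the set of strings up to inversion. Closure: for $\sigma,\tau\in\mathcal S^\pm(\bar Q)$, $\sigma\circ\tau$ is the set of undirected strings of the form $\sigma'\gamma^{\epsilon}\tau'$ with $\sigma'\in\{\sigma,\sigma^{ -1}\}$, $\tau'\in\{\tau,\tau^{ -1}\}$, $\gamma\in Q_1$, $\epsilon=\pm1$ (joining an endpoint of $\sigma$ to an endpoint of $\tau$ by one arrow); $S\circ T=\bigcup_{\sigma\in S,\tau\in T}\sigma\circ\tau$. For $S\subseteq\mathcal S^\pm(\bar Q)$, $\overline S=\bigcup_{\ell\ge1}\bigcup_{\sigma_1,\dots,\sigma_\ell\in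 S}\sigma_1\circ\cdots\circ\sigma_\ell$. $S$ is closed if $\overline S=S$, coclosed if its complement is closed, biclosed if both. A finite lattice $L$ is congruence-uniform if $x\mapsto\mathrm{con}(x_\star,x)$ is a bijection from join-irreducibles of $L$ to join-irreducibles of the lattice of congruences of $L$, and $x\mapsto\mathrm{con}(x,x^\star)$ is a bijection between the meet-irreducibles; $x_\star$ ($x^\star$) is the unique element covered by (covering) $x$ and $\mathrm{con}(x,y)$ the finest congruence identifying $x,y$.
   Formalization: In the definition of congruence-uniform, x ↦ con(x,x^⋆) is taken as a bijection from the meet-irreducibles of L to the join-irreducible (not meet-irreducible) congruences; the literal version fails for three vertices without arrows, where the lattice is Boolean of rank 3. -}

module Defs where

open import Algebra.Core using (Op₂)
open import Algebra.Definitions using (Congruent₂)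
open import Data.Bool.Base using (Bool; T)
open import Data.Fin.Base using (Fin)
open import Data.Fin.Properties using (_≟_)
open import Data.List.Base using (List; []; _∷_; _++_; allFin; filter; foldl; length; map; reverse)
open import Data.List.Relation.Binary.Infix.Heterogeneous using (Infix)
open import Data.List.Relation.Unary.All using (All)
open import Data.List.Relation.Unary.Enumerates.Setoid using (IsEnumeration)
open import Data.List.Relation.Unary.Linked using (Linked)
open import Data.Nat.Base using (ℕ; _≤_)
open import Data.Product.Base using (Σ-syntax; ∃; ∃₂; _×_; _,_; uncurry)
open import Data.Sign.Base using (Sign; opposite)
open import Data.Sum.Base using (_⊎_)
open import Data.Unit.Base using (⊤)
open import Function.Definitions using (Bijective)
open import Level using (Level; 0ℓ; _⊔_)
open import Relation.Binary.Bundles using (Poset; Setoid)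
open import Relation.Binary.Core using (Rel)
open import Relation.Binary.Lattice.Bundles using (Lattice)
open import Relation.Binary.Lattice.Structures using (IsLattice)
open import Relation.Binary.PropositionalEquality using (_≡_; _≢_; setoid)
open import Relation.Binary.Structures using (IsEquivalence)
open import Relation.Nullary.Negation using (¬_)
open import Relation.Unary using (Pred; _∈_; _≐_; ∁)
open import Relation.Unary.Relation.Binary.Subset using (⊆-poset)
import Relation.Binary.Construct.On as On

-- The ideal I is generated by the length-two paths αβ with T (rel α β).
-- Paths are composed from left to right.
record BoundQuiver : Set where
  field
    #vertices #arrows : ℕ

  Vertex : Set
  Vertex = Fin #vertices

  Arrow : Set
  Arrow = Fin #arrows

  field
    s t            : Arrow → Vertex
    rel            : Arrow → Arrow → Bool
    rel-composable : ∀ {α β} → T (rel α β) → t α ≡ s β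

  IsPath : Pred (List Arrow) 0ℓ
  IsPath = Linked (λ α β → t α ≡ s β)

  -- Paths of positive length lying in I.  As I is a monomial ideal, these are
  -- the paths having a generator as a factor; in particular a path αβ of
  -- length two lies in I exactly when T (rel α β).
  _∈I : Pred (List Arrow) 0ℓ
  π ∈I = IsPath π × (∃₂ λ α β → T (rel α β) × Infix _≡_ (α ∷ β ∷ []) π)

  -- That I is contained in the square of the arrow ideal is automatic.
  Admissible : Set
  Admissible = ∃ λ N → ∀ π → IsPath π → N ≤ length π → π ∈I

record IsGentle (Q : BoundQuiver) : Set where
  open BoundQuiver Q
  field
    admissible : Admissible
    incoming≤2 : ∀ v → length (filter (λ α → t α ≟ v) (allFin #arrows)) ≤ 2
    outgoing≤2 : ∀ v → length (filter (λ α → s α ≟ v) (allFin #arrows)) ≤ 2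
    pre∉I      : ∀ β {α α′} → t α ≡ s β → t α′ ≡ s β →
                 ¬ T (rel α β) → ¬ T (rel α′ β) → α ≡ α′
    pre∈I      : ∀ β {α α′} → T (rel α β) → T (rel α′ β) → α ≡ α′
    post∉I     : ∀ β {γ γ′} → s γ ≡ t β → s γ′ ≡ t β →
                 ¬ T (rel β γ) → ¬ T (rel β γ′) → γ ≡ γ′
    post∈I     : ∀ β {γ γ′} → T (rel β γ) → T (rel β γ′) → γ ≡ γ′

record GentleBoundQuiver : Set where
  field
    boundQuiver : BoundQuiver
    isGentle    : IsGentle boundQuiver

  open BoundQuiver boundQuiver public
  open IsGentle isGentle public

module Strings (Q : BoundQuiver) where
  open BoundQuiver Q

  -- (α , ε) stands for α^ε.
  Letter : Set
  Letter = Arrow × Sign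

  src tgt : Letter → Vertex
  src (α , Sign.+) = s α
  src (α , Sign.-) = t α
  tgt (α , Sign.+) = t α
  tgt (α , Sign.-) = s α

  flip : Letter → Letter
  flip (α , ε) = α , opposite ε

  flips : List Letter → List Letter
  flips ls = reverse (map flip ls)

  -- A word carries its source vertex, so that the trivial word ε_v is
  -- word v []; for a nonempty word, Composable makes the source redundant.
  record Word : Set where
    constructor word
    field
      start   : Vertex
      letters : List Letter

    end : Vertex
    end = foldl (λ _ ℓ → tgt ℓ) start letters

  open Word public

  _⁻¹ : Word → Word
  w ⁻¹ = word (end w) (flips (letters w))

  Composable : Vertex → List Letter → Set
  Composable v []       = ⊤
  Composable v (ℓ ∷ ls) = src ℓ ≡ v × Composable (tgt ℓ) ls

  record IsString (w : Word) : Set where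
    field
      composable : Composable (start w) (letters w)
      reduced    : Linked (λ ℓ ℓ′ → ℓ′ ≢ flip ℓ) (letters w)
      avoids-I   : ∀ π → π ∈I → ¬ Infix _≡_ (map (_, Sign.+) π) (letters w)
      avoids-I⁻¹ : ∀ π → π ∈I → ¬ Infix _≡_ (flips (map (_, Sign.+) π)) (letters w)

  record String : Set where
    field
      underlying : Word
      isString   : IsString underlying

  open String public

  -- Strings are compared through their underlying words.
  stringSetoid : Setoid 0ℓ 0ℓ
  stringSetoid = On.setoid (setoid Word) underlying

  FinitelyManyStrings : Set
  FinitelyManyStrings = Σ[ σs ∈ List String ] IsEnumeration stringSetoid σs

  _≈±_ : Rel Word 0ℓ
  w ≈± w′ = w ≡ w′ ⊎ w ≡ w′ ⁻¹

  -- An undirected string is represented by either of its two orientations: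
  -- the predicates below on String are all invariant under _≈±_.
  ⟨_⟩ : String → Pred String 0ℓ
  ⟨ σ ⟩ ρ = underlying ρ ≈± underlying σ

  _∘ˢ_ : String → String → Pred String 0ℓ
  (σ ∘ˢ τ) ρ = Σ[ σ′ ∈ Word ] Σ[ ℓ ∈ Letter ] Σ[ τ′ ∈ Word ]
    σ′ ≈± underlying σ × τ′ ≈± underlying τ ×
    end σ′ ≡ src ℓ × tgt ℓ ≡ start τ′ ×
    underlying ρ ≈± word (start σ′) (letters σ′ ++ ℓ ∷ letters τ′)

  _∘_ : Pred String 0ℓ → Pred String 0ℓ → Pred String 0ℓ
  (S ∘ T) ρ = ∃₂ λ σ τ → σ ∈ S × τ ∈ T × ρ ∈ (σ ∘ˢ τ)

  -- σ₁ ∘ ⋯ ∘ σ_ℓ, associated to the left.  The operation ∘ is not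
  -- associative, but the union over all sequences defining the closure does
  -- not depend on the bracketing.
  composites : String → List String → Pred String 0ℓ
  composites σ τs = foldl (λ S τ → S ∘ ⟨ τ ⟩) ⟨ σ ⟩ τs

  closure : Pred String 0ℓ → Pred String 0ℓ
  closure S ρ = ∃₂ λ σ τs → All S (σ ∷ τs) × ρ ∈ composites σ τs

  Closed Coclosed : Pred (Pred String 0ℓ) 0ℓ
  Closed S   = closure S ≐ S
  Coclosed S = Closed (∁ S)

  -- A set of undirected strings.  When there are finitely many strings, taking
  -- sets to be decidable is classically no restriction.
  record StringSet : Set where
    field
      member      : String → Bool
      member-resp : ∀ {σ τ} → underlying σ ≈± underlying τ → member σ ≡ member τ

    ⟦_⟧ : Pred String 0ℓ
    ⟦_⟧ σ = T (member σ)

  open StringSet public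

  record BiclosedSet : Set where
    field
      stringSet : StringSet
      closed    : Closed ⟦ stringSet ⟧
      coclosed  : Coclosed ⟦ stringSet ⟧

  Bicl : Poset 0ℓ 0ℓ 0ℓ
  Bicl = On.poset (⊆-poset String 0ℓ) (λ S → ⟦ BiclosedSet.stringSet S ⟧)

FinitelyManyStrings : GentleBoundQuiver → Set
FinitelyManyStrings Q = Strings.FinitelyManyStrings (GentleBoundQuiver.boundQuiver Q)

Bicl : GentleBoundQuiver → Poset 0ℓ 0ℓ 0ℓ
Bicl Q = Strings.Bicl (GentleBoundQuiver.boundQuiver Q)

module Irreducibles {c ℓ₁ ℓ₂ : Level} (P : Poset c ℓ₁ ℓ₂) where
  open Poset P renaming (_≤_ to _⊑_)

  _⊏_ : Rel Carrier (ℓ₁ ⊔ ℓ₂)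
  x ⊏ y = x ⊑ y × ¬ (x ≈ y)

  _⋖_ : Rel Carrier (c ⊔ ℓ₁ ⊔ ℓ₂)
  x ⋖ y = x ⊏ y × (∀ z → ¬ (x ⊏ z × z ⊏ y))

  -- An element of a finite lattice is join-irreducible (meet-irreducible) when
  -- it covers (is covered by) exactly one element.
  record JoinIrreducible : Set (c ⊔ ℓ₁ ⊔ ℓ₂) where
    field
      element : Carrier
      lower   : Carrier
      covers  : lower ⋖ element
      unique  : ∀ {y} → y ⋖ element → y ≈ lower

  record MeetIrreducible : Set (c ⊔ ℓ₁ ⊔ ℓ₂) where
    field
      element : Carrier
      upper   : Carrier
      covered : element ⋖ upper
      unique  : ∀ {y} → element ⋖ y → y ≈ upper

  _≈ʲ_ : Rel JoinIrreducible ℓ₁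
  x ≈ʲ y = JoinIrreducible.element x ≈ JoinIrreducible.element y

  _≈ᵐ_ : Rel MeetIrreducible ℓ₁
  x ≈ᵐ y = MeetIrreducible.element x ≈ MeetIrreducible.element y

module Congruences {c ℓ₁ ℓ₂ : Level} (L : Lattice c ℓ₁ ℓ₂) where
  open Lattice L using (Carrier; _≈_; _∨_; _∧_)

  -- Every congruence of a finite lattice is classically decidable.
  record Congruence : Set (c ⊔ ℓ₁) where
    field
      related : Carrier → Carrier → Bool

    _∼_ : Rel Carrier 0ℓ
    x ∼ y = T (related x y)

    field
      ∼-resp-≈      : ∀ {x y} → x ≈ y → x ∼ y
      isEquivalence : IsEquivalence _∼_
      ∨-cong        : Congruent₂ _∼_ _∨_
      ∧-cong        : Congruent₂ _∼_ _∧_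

  Con : Poset (c ⊔ ℓ₁) c c
  Con = On.poset (⊆-poset (Carrier × Carrier) 0ℓ) (λ θ → uncurry (Congruence._∼_ θ))

  -- θ = con(x , y)
  IsCon : Carrier → Carrier → Congruence → Set (c ⊔ ℓ₁)
  IsCon x y θ = Congruence._∼_ θ x y ×
                (∀ φ → Congruence._∼_ φ x y → Poset._≤_ Con θ φ)

module _ {c ℓ₁ ℓ₂ : Level} (L : Lattice c ℓ₁ ℓ₂) where
  open Congruences L
  open Lattice L using (Carrier) renaming (poset to P; setoid to S)
  private
    module P   = Irreducibles P
    module Con = Irreducibles Con

  -- In both bijections the codomain consists of the join-irreducible
  -- congruences: con(x , x^⋆) is join-irreducible in Con L, and in general not
  -- meet-irreducible (in the Boolean lattice with three atoms it is an atom of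
  -- Con L, which is again Boolean with three atoms).
  record CongruenceUniform : Set (c ⊔ ℓ₁ ⊔ ℓ₂) where
    field
      finite : Σ[ xs ∈ List Carrier ] IsEnumeration S xs
      join-irreducibles :
        Σ[ f ∈ (P.JoinIrreducible → Con.JoinIrreducible) ]
          (∀ x → IsCon (P.JoinIrreducible.lower x) (P.JoinIrreducible.element x)
                       (Con.JoinIrreducible.element (f x))) ×
          Bijective P._≈ʲ_ Con._≈ʲ_ f
      meet-irreducibles :
        Σ[ f ∈ (P.MeetIrreducible → Con.JoinIrreducible) ]
          (∀ x → IsCon (P.MeetIrreducible.element x) (P.MeetIrreducible.upper x)
                       (Con.JoinIrreducible.element (f x))) ×
          Bijective P._≈ᵐ_ Con._≈ʲ_ f

record IsCongruenceUniformLattice {c ℓ₁ ℓ₂ : Level} (P : Poset c ℓ₁ ℓ₂) : Set (c ⊔ ℓ₁ ⊔ ℓ₂) where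
  open Poset P using (Carrier; _≈_) renaming (_≤_ to _⊑_)
  field
    _∨_ _∧_   : Op₂ Carrier
    isLattice : IsLattice _≈_ _⊑_ _∨_ _∧_

  lattice : Lattice c ℓ₁ ℓ₂
  lattice = record { isLattice = isLattice }

  field
    congruenceUniform : CongruenceUniform lattice

{-# OPTIONS --safe #-}

-- Biclosed sets are stable under complement, and the join of two of them is
-- the set of concatenations of their elements: a cut of such a concatenation
-- passes between two pieces, or cuts a piece into two halves one of which lies
-- in the same biclosed set.
--
-- In a finite lattice, j ↦ con(j₋ , j) always maps the join-irreducibles onto
-- the join-irreducible congruences, so only its injectivity is specific to
-- biclosed sets.  Let σ be a shortest string in j ∖ j₋.  The set j contains
-- exactly one half of each cut of σ, and the relation "X and Y contain the same
-- strings shorter than σ, and if X contains the same halves of cuts of σ as j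
-- then X and Y agree on σ" is a congruence that does not contract j.  If
-- con(j₋ , j) = con(k₋ , k), then k is not contracted either, so that σ lies in
-- k ∖ k₋ and k contains the same halves as j.  This puts σ in j ∧ k, which is
-- therefore not below j₋ or k₋, and j = j ∧ k = k.  Meet-irreducibles are
-- handled by complementation.
module Submission where

open import Defs
open import Algebra.Core using (Op₁)
import Data.Bool.Base as Bool
open import Data.Bool.Base using (Bool; T; not)
import Data.Bool.Properties as Bool
open import Data.Bool.Properties using (T?; T-∧; T-≡; ⇔→≡)
open import Data.Fin.Base using (Fin; combine; remQuot; finToFun; funToFin)
import Data.Fin.Properties as Fin
open import Data.List.Base using (List; []; _∷_; _++_; _∷ʳ_; [_]; allFin; cartesianProduct; concatMap; foldl; length; lookup; map; reverse)
import Data.List.Properties as List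
open import Data.List.Relation.Binary.Infix.Heterogeneous using (Infix; there; _++ⁱ_; _ⁱ++_)
open import Data.List.Relation.Unary.All as All using (All; []; _∷_)
open import Data.List.Relation.Unary.Any as Any using (Any; here; index)
import Data.List.Relation.Unary.Any.Properties as Any
open import Data.List.Relation.Unary.Enumerates.Setoid using (IsEnumeration)
import Data.List.Relation.Unary.Enumerates.Setoid.Properties as Enumerates
open import Data.List.Relation.Unary.Linked using (Linked; []; [-]; _∷_)
import Data.Nat.Base as ℕ
open import Data.Nat.Base using (ℕ; suc; _+_; _*_; _^_; _<_; z≤n; s≤s)
import Data.Nat.Properties as ℕ
open import Data.Product.Base using (Σ-syntax; ∃; ∃₂; _×_; _,_; proj₁; proj₂; swap; uncurry)
import Data.Product.Properties as Product
open import Data.Sign.Base using (Sign)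
import Data.Sign.Properties as Sign
open import Data.Sum.Base as Sum using (_⊎_; inj₁; inj₂)
open import Function.Base using (_∘_; _on_; case_of_; id)
open import Function.Bundles using (Equivalence; Inverse; _⇔_; mk⇔)
open import Function.Definitions using (Bijective)
open import Level using (Level; 0ℓ; _⊔_)
open import Relation.Binary.Bundles using (Poset)
open import Relation.Binary.Core using (Rel)
open import Relation.Binary.Definitions using (Decidable; DecidableEquality; Reflexive; Transitive; _Respects_)
open import Relation.Binary.Lattice.Bundles using (Lattice)
import Relation.Binary.Lattice.Properties.JoinSemilattice as JoinSemilattice
open import Relation.Binary.Lattice.Structures using (IsLattice)
open import Relation.Binary.PropositionalEquality as ≡ using (_≡_; _≗_; refl; sym; trans; cong; cong₂; subst; subst₂; module ≡-Reasoning)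
open import Relation.Binary.Structures using (IsEquivalence)
open import Relation.Nullary.Decidable using (Dec; yes; no; ¬?; _×-dec_; _⊎-dec_; _→-dec_; map′; ⌊_⌋; toWitness; fromWitness; decidable-stable)
open import Relation.Nullary.Negation using (¬_; contradiction)
import Relation.Unary as Unary
open import Relation.Unary using (Pred; _∪_)

private variable
  a c ℓ ℓ₁ ℓ₂ p : Level
  n : ℕ

-- Minimal elements of lists, and enumeration by Boolean tables.

module _ {A : Set a} {_≲_ : Rel A ℓ} (≲-refl : Reflexive _≲_) (≲-trans : Transitive _≲_)
         (_≲?_ : Decidable _≲_) {P : Pred A p} (P? : Unary.Decidable P) where

  -- One pass suffices: the candidate only decreases, so an element that is rejected once is not
  -- below any later candidate. A preorder is enough, which allows strings to be compared by length.
  minimalIn : ∀ ys {x} → P x →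
              ∃ λ m → P m × m ≲ x × All (λ y → P y → y ≲ m → m ≲ y) ys
  minimalIn []       px = _ , px , ≲-refl , []
  minimalIn (y ∷ ys) {x} px with P? y ×-dec (y ≲? x)
  ... | yes (py , y≲x) =
    let m , pm , m≲y , min = minimalIn ys py in
    m , pm , ≲-trans m≲y y≲x , (λ _ _ → m≲y) ∷ min
  ... | no ¬py =
    let m , pm , m≲x , min = minimalIn ys px in
    m , pm , m≲x , (λ py y≲m → contradiction (py , ≲-trans y≲m m≲x) ¬py) ∷ min

T-injective : ∀ {x y} → (T x → T y) → (T y → T x) → x ≡ y
T-injective {x} x⇒y y⇒x = ⇔→≡ {x} (mk⇔ (to T-≡ ∘ x⇒y ∘ from T-≡) (to T-≡ ∘ y⇒x ∘ from T-≡))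
  where open Equivalence

bits : Fin (2 ^ n) → Fin n → Bool
bits k = Inverse.to Fin.2↔Bool ∘ finToFun k

bits-surjective : (f : Fin n → Bool) → ∃ λ k → bits k ≗ f
bits-surjective f = funToFin g , λ i →
  ≡.trans (cong (Inverse.to Fin.2↔Bool) (Fin.finToFun-funToFin g i))
          (Inverse.strictlyInverseˡ Fin.2↔Bool (f i))
  where
  g = Inverse.from Fin.2↔Bool ∘ f

module _ {C : Set c} (table : C → Fin n → Bool)
         (realizable? : ∀ f → Dec (∃ λ x → table x ≗ f))
         {R : Rel C ℓ} (table⇒R : ∀ {x y} → table x ≗ table y → R x y) where

  private
    realization : Fin (2 ^ n) → List C
    realization k with realizable? (bits k)
    ... | yes (x , _) = [ x ]
    ... | no  _       = []

    realization-complete : ∀ x k → bits k ≗ table x →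
                           Any (R x) (realization k)
    realization-complete x k k≗x with realizable? (bits k)
    ... | yes (y , y≗k) = here (table⇒R λ i → ≡.sym (≡.trans (y≗k i) (k≗x i)))
    ... | no  ∄y        = contradiction (x , ≡.sym ∘ k≗x) ∄y

  -- Every Boolean table is tried, and one realization is kept for each table that has one. As equal
  -- tables imply `R`, that realization represents all elements with the same table.
  enumerateTables : Σ[ xs ∈ List C ] (∀ x → Any (R x) xs)
  enumerateTables = concatMap realization (allFin _) , λ x →
    let k , k≗x = bits-surjective (table x) in
    Any.concatMap⁺ realization (Any.tabulate⁺ k (realization-complete x k k≗x))

-- Finite posets and lattices

module FinitePoset (P : Poset c ℓ₁ ℓ₂) (_≤?_ : Decidable (Poset._≤_ P))
                   {xs : List (Poset.Carrier P)}
                   (enumeration : IsEnumeration (Poset.Eq.setoid P) xs) where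
  open Poset P renaming (trans to ≤-trans; refl to ≤-refl; reflexive to ≤-reflexive)
  open Irreducibles P
  open JoinIrreducible

  private
    everywhere : {Q : Pred Carrier p} → Q Respects _≈_ → All Q xs → ∀ x → Q x
    everywhere resp all x =
      All.lookupWith (λ Qy x≈y → resp (Eq.sym x≈y) Qy) all (enumeration x)

  minimal : {Q : Pred Carrier p} → Unary.Decidable Q → Q Respects _≈_ → ∀ {x} → Q x →
            ∃ λ m → Q m × m ≤ x × (∀ y → Q y → y ≤ m → m ≤ y)
  minimal Q? resp Qx =
    let m , Qm , m≤x , min = minimalIn ≤-refl ≤-trans _≤?_ Q? xs Qx in
    m , Qm , m≤x , everywhere
      (λ y≈z f Qz z≤m → ≤-respʳ-≈ y≈z (f (resp (Eq.sym y≈z) Qz) (≤-respˡ-≈ (Eq.sym y≈z) z≤m))) min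

  maximal : {Q : Pred Carrier p} → Unary.Decidable Q → Q Respects _≈_ → ∀ {x} → Q x →
            ∃ λ m → Q m × x ≤ m × (∀ y → Q y → m ≤ y → y ≤ m)
  maximal Q? resp Qx =
    let m , Qm , x≤m , max = minimalIn {_≲_ = λ y z → z ≤ y} ≤-refl (λ p q → ≤-trans q p) (λ y z → z ≤? y) Q? xs Qx in
    m , Qm , x≤m , everywhere
      (λ y≈z f Qz m≤z → ≤-respˡ-≈ y≈z (f (resp (Eq.sym y≈z) Qz) (≤-respʳ-≈ (Eq.sym y≈z) m≤z))) max

  lower≤ : ∀ j → lower j ≤ element j
  lower≤ j = proj₁ (proj₁ (covers j))

  ≰lower : ∀ j → ¬ (element j ≤ lower j)
  ≰lower j j≤j₋ = proj₂ (proj₁ (covers j)) (antisym (lower≤ j) j≤j₋)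

  -- A maximal `w` above `x` among the elements strictly below `j` is covered by `j`, hence is the
  -- unique lower cover.
  strictlyBelow⇒≤lower : ∀ j {x} → x ≤ element j → ¬ (element j ≤ x) → x ≤ lower j
  strictlyBelow⇒≤lower j x≤j j≰x =
    let w , (w≤j , j≰w) , x≤w , max =
          maximal (λ w → (w ≤? element j) ×-dec ¬? (element j ≤? w))
            (λ y≈z (y≤j , j≰y) → ≤-respˡ-≈ y≈z y≤j , j≰y ∘ ≤-respʳ-≈ (Eq.sym y≈z)) (x≤j , j≰x)
        w⋖j = (w≤j , j≰w ∘ ≤-reflexive ∘ Eq.sym) , λ z ((w≤z , w≉z) , (z≤j , z≉j)) →
                w≉z (antisym w≤z (max z (z≤j , z≉j ∘ antisym z≤j) w≤z))
    in ≤-trans x≤w (≤-reflexive (unique j w⋖j))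

  lower-cong : ∀ j k → j ≈ʲ k → lower j ≤ lower k
  lower-cong j k j≈k = strictlyBelow⇒≤lower k (≤-respʳ-≈ j≈k (lower≤ j))
    (≰lower j ∘ ≤-respˡ-≈ (Eq.sym j≈k))

module _ (P : Poset c ℓ₁ ℓ₂) (stable : ∀ {x y} → ¬ ¬ Poset._≤_ P x y → Poset._≤_ P x y) where
  open Poset P
  open Irreducibles P

  -- Any `y` covered by `j` lies below `j₋`; were `j₋` not below `y`, it would lie strictly between
  -- `y` and `j`. Stability of the order turns this into an equality.
  fromGreatestBelow : ∀ j j₋ → j₋ ≤ j → ¬ (j ≤ j₋) →
                      (∀ z → z ≤ j → ¬ (j ≤ z) → z ≤ j₋) → JoinIrreducible
  fromGreatestBelow j j₋ j₋≤j j≰j₋ greatest = record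
    { element = j
    ; lower   = j₋
    ; covers  = j₋⊏j , λ z ((j₋≤z , j₋≉z) , (z≤j , z≉j)) →
                  j₋≉z (antisym j₋≤z (greatest z z≤j (z≉j ∘ antisym z≤j)))
    ; unique  = λ {y} ((y≤j , y≉j) , nothingBetween) →
        let y≤j₋ = greatest y y≤j (y≉j ∘ antisym y≤j) in
        antisym y≤j₋ (stable λ j₋≰y →
          nothingBetween j₋ ((y≤j₋ , j₋≰y ∘ reflexive ∘ Eq.sym) , j₋⊏j))
    }
    where
    j₋⊏j = j₋≤j , j≰j₋ ∘ reflexive ∘ Eq.sym

module FiniteLattice (L : Lattice c ℓ₁ ℓ₂) (_≤?_ : Decidable (Lattice._≤_ L))
                     {xs : List (Lattice.Carrier L)}
                     (enumeration : IsEnumeration (Lattice.setoid L) xs) where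
  open Lattice L renaming (trans to ≤-trans; refl to ≤-refl; reflexive to ≤-reflexive) hiding (isEquivalence)
  open JoinSemilattice joinSemilattice using (∨-comm; x≤y⇒x∨y≈y) renaming (∨-cong to ∨-cong-≈; ∨-monotonic to ∨-mono)
  open FinitePoset poset _≤?_ enumeration
  open Irreducibles poset
  open JoinIrreducible
  open Congruences L
  module Con = Irreducibles Con

  x≤y⇒x∧y≈x : ∀ {x y} → x ≤ y → x ∧ y ≈ x
  x≤y⇒x∧y≈x x≤y = antisym (x∧y≤x _ _) (∧-greatest ≤-refl x≤y)

  ∧-comm : ∀ x y → x ∧ y ≈ y ∧ x
  ∧-comm x y = antisym (∧-greatest (x∧y≤y x y) (x∧y≤x x y)) (∧-greatest (x∧y≤y y x) (x∧y≤x y x))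

  ∧-cong-≈ : ∀ {x y u v} → x ≈ y → u ≈ v → x ∧ u ≈ y ∧ v
  ∧-cong-≈ x≈y u≈v = antisym
    (∧-greatest (≤-respʳ-≈ x≈y (x∧y≤x _ _)) (≤-respʳ-≈ u≈v (x∧y≤y _ _)))
    (∧-greatest (≤-respʳ-≈ (Eq.sym x≈y) (x∧y≤x _ _)) (≤-respʳ-≈ (Eq.sym u≈v) (x∧y≤y _ _)))

  -- Take `m` minimal among the elements below `x` but not below `y`. Everything strictly below `m`
  -- is then below `y`, so `m ∧ y` is the greatest element strictly below `m`.
  separating : ∀ {x y} → ¬ (x ≤ y) →
    Σ[ j ∈ JoinIrreducible ] element j ≤ x × ¬ (element j ≤ y) × lower j ≤ y
  separating {x} {y} x≰y =
    let m , (m≤x , m≰y) , _ , min =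
          minimal (λ w → (w ≤? x) ×-dec ¬? (w ≤? y))
            (λ v≈w (v≤x , v≰y) → ≤-respˡ-≈ v≈w v≤x , v≰y ∘ ≤-respˡ-≈ (Eq.sym v≈w))
            (≤-refl , x≰y)
    in fromGreatestBelow poset (λ {u} {v} → decidable-stable (u ≤? v)) m (m ∧ y) (x∧y≤x m y)
         (λ m≤m∧y → m≰y (≤-trans m≤m∧y (x∧y≤y m y)))
         (λ z z≤m m≰z → ∧-greatest z≤m (decidable-stable (z ≤? y)
           λ z≰y → m≰z (min z (≤-trans z≤m m≤x , z≰y) z≤m)))
       , m≤x , m≰y , x∧y≤y m y

  -- Each join-irreducible j is found, as the one separating j from j₋.
  joinIrreducibles : List JoinIrreducible
  joinIrreducibles = concatMap (uncurry candidates) (cartesianProduct xs xs)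
    module Candidates where
    candidates : Carrier → Carrier → List JoinIrreducible
    candidates x y with x ≤? y
    ... | yes _   = []
    ... | no  x≰y = [ proj₁ (separating x≰y) ]

  joinIrreducibles-complete : ∀ j → Any (j ≈ʲ_) joinIrreducibles
  joinIrreducibles-complete j =
    Any.concatMap⁺ (uncurry Candidates.candidates)
      (Any.map (λ { {x , y} (j≈x , j₋≈y) → candidate x y j≈x j₋≈y })
        (Enumerates.cartesianProduct⁺ setoid setoid enumeration enumeration (element j , lower j)))
    where
    candidate : ∀ x y → element j ≈ x → lower j ≈ y → Any (j ≈ʲ_) (Candidates.candidates x y)
    candidate x y j≈x j₋≈y with x ≤? y
    ... | yes x≤y = contradiction (≤-respˡ-≈ (Eq.sym j≈x) (≤-respʳ-≈ (Eq.sym j₋≈y) x≤y)) (≰lower j)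
    ... | no  x≰y =
      let k , k≤x , k≰y , _ = separating x≰y
          k≤j = ≤-respʳ-≈ (Eq.sym j≈x) k≤x in
      here (antisym (decidable-stable (_ ≤? _) λ j≰k →
              k≰y (≤-respʳ-≈ j₋≈y (strictlyBelow⇒≤lower j k≤j j≰k))) k≤j)

  -- Join-irreducibles contracted by a congruence.

  module _ (θ : Congruence) where
    open Congruence θ
    private module ∼ = IsEquivalence isEquivalence

    ∼-resp : ∀ {x x′ y y′} → x ≈ x′ → y ≈ y′ → x ∼ y → x′ ∼ y′
    ∼-resp x≈x′ y≈y′ x∼y = ∼.trans (∼-resp-≈ (Eq.sym x≈x′)) (∼.trans x∼y (∼-resp-≈ y≈y′))

    Contracts : Pred JoinIrreducible _
    Contracts j = lower j ∼ element j

    contracts-resp : ∀ {j k} → j ≈ʲ k → Contracts j → Contracts k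
    contracts-resp {j} {k} j≈k =
      ∼-resp (antisym (lower-cong j k j≈k) (lower-cong k j (Eq.sym j≈k))) j≈k

    -- Meet both sides of `x ∼ y` with `j` and then join them with `j₋`. The first becomes `j`; the
    -- second becomes `j₋`, because `y ∧ j` is strictly below `j`.
    separated⇒contracts : ∀ j {x y} → x ∼ y → element j ≤ x → ¬ (element j ≤ y) → Contracts j
    separated⇒contracts j {x} {y} x∼y j≤x j≰y = ∼.sym
      (∼-resp (Eq.trans (∨-cong-≈ (Eq.trans (∧-comm x _) (x≤y⇒x∧y≈x j≤x)) Eq.refl)
                        (Eq.trans (∨-comm _ _) (x≤y⇒x∨y≈y (lower≤ j))))
              (x≤y⇒x∨y≈y (strictlyBelow⇒≤lower j (x∧y≤y y _)
                 λ j≤y∧j → j≰y (≤-trans j≤y∧j (x∧y≤x y _))))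
        (∨-cong (∧-cong x∼y (∼.refl {element j})) (∼.refl {lower j})))

    contracts⇒∼ : ∀ j {w} → Contracts j → lower j ≤ w → w ∼ (element j ∨ w)
    contracts⇒∼ j {w} jθ j₋≤w = ∼-resp (x≤y⇒x∨y≈y j₋≤w) Eq.refl (∨-cong jθ (∼.refl {w}))

  -- Enumeration of the congruences.

  private
    el : Fin (length xs) → Carrier
    el = lookup xs

    -- The enumeration may repeat elements, so x ≈ y does not give idx x ≡ idx y.
    idx : Carrier → Fin (length xs)
    idx x = index (enumeration x)

    el-idx : ∀ x → x ≈ el (idx x)
    el-idx x = Any.lookup-index (enumeration x)

    _≈?_ : Decidable _≈_
    x ≈? y = map′ (uncurry antisym) (λ x≈y → ≤-reflexive x≈y , ≤-reflexive (Eq.sym x≈y))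
                  ((x ≤? y) ×-dec (y ≤? x))

    Table = Fin (length xs * length xs) → Bool

    holds : Table → Rel Carrier _
    holds f x y = T (f (combine (idx x) (idx y)))

    holdsᶠ : Table → Rel (Fin (length xs)) _
    holdsᶠ f i j = T (f (combine i j))

    -- Quantifying over indices makes the condition decidable. Reflexivity is part of `resp`, and
    -- `euclid` merges symmetry with transitivity.
    record Congruential (f : Table) : Set (c ⊔ ℓ₁) where
      constructor congruential
      field
        resp   : ∀ i j → el i ≈ el j → holdsᶠ f i j
        euclid : ∀ i j k → holdsᶠ f i j → holdsᶠ f k j → holdsᶠ f i k
        ∨-comp : ∀ i j k l → holdsᶠ f i j → holdsᶠ f k l → holds f (el i ∨ el k) (el j ∨ el l)
        ∧-comp : ∀ i j k l → holdsᶠ f i j → holdsᶠ f k l → holds f (el i ∧ el k) (el j ∧ el l)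

    congruential? : ∀ f → Dec (Congruential f)
    congruential? f = map′ (λ (r , e , j , m) → congruential r e j m)
                           (λ (congruential r e j m) → r , e , j , m)
      ((Fin.all? λ i → Fin.all? λ j → (el i ≈? el j) →-dec T? _) ×-dec
       (Fin.all? λ i → Fin.all? λ j → Fin.all? λ k → T? _ →-dec (T? _ →-dec T? _)) ×-dec
       (Fin.all? λ i → Fin.all? λ j → Fin.all? λ k → Fin.all? λ l → T? _ →-dec (T? _ →-dec T? _)) ×-dec
       (Fin.all? λ i → Fin.all? λ j → Fin.all? λ k → Fin.all? λ l → T? _ →-dec (T? _ →-dec T? _)))

    table : Congruence → Table
    table θ = (λ (i , j) → Congruence.related θ (el i) (el j)) ∘ remQuot (length xs)

    table-combine : ∀ θ i j → table θ (combine i j) ≡ Congruence.related θ (el i) (el j)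
    table-combine θ i j =
      cong (λ (i , j) → Congruence.related θ (el i) (el j)) (Fin.remQuot-combine i j)

    congruence : ∀ {f} → Congruential f → Congruence
    congruence {f} (congruential resp euclid ∨-comp ∧-comp) = record
      { related       = λ x y → f (combine (idx x) (idx y))
      ; ∼-resp-≈      = ≈⇒f
      ; isEquivalence = record
        { refl  = ≈⇒f Eq.refl
        ; sym   = λ x∼y → euclid _ _ _ (≈⇒f Eq.refl) x∼y
        ; trans = ∼-trans
        }
      ; ∨-cong = λ x∼y u∼v → ∼-trans (≈⇒f (∨-cong-≈ (el-idx _) (el-idx _)))
                   (∼-trans (∨-comp _ _ _ _ x∼y u∼v) (≈⇒f (Eq.sym (∨-cong-≈ (el-idx _) (el-idx _)))))
      ; ∧-cong = λ x∼y u∼v → ∼-trans (≈⇒f (∧-cong-≈ (el-idx _) (el-idx _)))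
                   (∼-trans (∧-comp _ _ _ _ x∼y u∼v) (≈⇒f (Eq.sym (∧-cong-≈ (el-idx _) (el-idx _)))))
      }
      where
      ≈⇒f : ∀ {x y} → x ≈ y → holds f x y
      ≈⇒f x≈y = resp _ _ (Eq.trans (Eq.sym (el-idx _)) (Eq.trans x≈y (el-idx _)))

      ∼-trans : ∀ {x y z} → holds f x y → holds f y z → holds f x z
      ∼-trans x∼y y∼z = euclid _ _ _ x∼y (euclid _ _ _ (≈⇒f Eq.refl) y∼z)

    table-congruential : ∀ θ {f} → table θ ≗ f → Congruential f
    table-congruential θ {f} θ≗f = congruential
      (λ i j → to i j ∘ ∼-resp-≈)
      (λ i j k i∼j k∼j → to i k (∼.trans (from i j i∼j) (∼.sym (from k j k∼j))))
      (λ i j k l i∼j k∼l → to _ _ (∼-resp θ (el-idx _) (el-idx _) (∨-cong (from i j i∼j) (from k l k∼l))))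
      (λ i j k l i∼j k∼l → to _ _ (∼-resp θ (el-idx _) (el-idx _) (∧-cong (from i j i∼j) (from k l k∼l))))
      where
      open Congruence θ
      module ∼ = IsEquivalence isEquivalence
      eq : ∀ i j → related (el i) (el j) ≡ f (combine i j)
      eq i j = ≡.trans (≡.sym (table-combine θ i j)) (θ≗f (combine i j))
      to : ∀ i j → el i ∼ el j → holdsᶠ f i j
      to i j = subst T (eq i j)
      from : ∀ i j → holdsᶠ f i j → el i ∼ el j
      from i j = subst T (≡.sym (eq i j))

    table-congruence : ∀ {f} (F : Congruential f) → table (congruence F) ≗ f
    table-congruence {f} F k = begin
      table (congruence F) k           ≡⟨ cong (table (congruence F)) (Fin.combine-remQuot {length xs} (length xs) k) ⟨
      table (congruence F) (combine i j) ≡⟨ table-combine (congruence F) i j ⟩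
      -- The indices `idx (el i)` and `i` may differ, but they name equivalent elements, which
      -- `resp` relates.
      f (combine (idx (el i)) (idx (el j))) ≡⟨ T-injective
        (λ h → ∼-trans (resp _ _ (el-idx (el i))) (∼-trans h (resp _ _ (Eq.sym (el-idx (el j))))))
        (λ h → ∼-trans (resp _ _ (Eq.sym (el-idx (el i)))) (∼-trans h (resp _ _ (el-idx (el j))))) ⟩
      f (combine i j)                   ≡⟨ cong f (Fin.combine-remQuot {length xs} (length xs) k) ⟩
      f k                               ∎
      where
      open ≡.≡-Reasoning
      open Congruential F
      i = proj₁ (remQuot {length xs} (length xs) k)
      j = proj₂ (remQuot {length xs} (length xs) k)
      ∼-trans : ∀ {i j k} → holdsᶠ f i j → holdsᶠ f j k → holdsᶠ f i k
      ∼-trans {j = j} i∼j j∼k = euclid _ _ _ i∼j (euclid _ _ _ (resp _ _ Eq.refl) j∼k)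

    table-⊆ : ∀ θ φ → table θ ≗ table φ → Poset._≤_ Con θ φ
    table-⊆ θ φ θ≗φ {x , y} xθy =
      ∼-resp φ (Eq.sym (el-idx x)) (Eq.sym (el-idx y))
        (subst T (≡.trans (≡.sym (table-combine θ (idx x) (idx y)))
                   (≡.trans (θ≗φ (combine (idx x) (idx y))) (table-combine φ (idx x) (idx y))))
          (∼-resp θ (el-idx x) (el-idx y) xθy))

    table-≈ : ∀ {θ φ} → table θ ≗ table φ → Poset._≈_ Con θ φ
    table-≈ {θ} {φ} θ≗φ = table-⊆ θ φ θ≗φ , table-⊆ φ θ (≡.sym ∘ θ≗φ)

    realizable? : ∀ f → Dec (∃ λ θ → table θ ≗ f)
    realizable? f = map′ (λ F → congruence F , table-congruence F)
                         (λ (θ , θ≗f) → table-congruential θ θ≗f) (congruential? f)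

    enumerated : Σ[ θs ∈ List Congruence ] IsEnumeration (Poset.Eq.setoid Con) θs
    enumerated = enumerateTables table realizable? {Poset._≈_ Con} (λ {θ} {φ} → table-≈ {θ} {φ})

  congruences : List Congruence
  congruences = proj₁ enumerated

  congruences-enumeration : IsEnumeration (Poset.Eq.setoid Con) congruences
  congruences-enumeration = proj₂ enumerated

  _⊆?_ : Decidable (Poset._≤_ Con)
  θ ⊆? φ = map′
    (λ θ⊆φ {(x , y)} xθy → ∼-resp φ (Eq.sym (el-idx x)) (Eq.sym (el-idx y))
      (θ⊆φ (idx x) (idx y) (∼-resp θ (el-idx x) (el-idx y) xθy)))
    (λ θ⊆φ i j → θ⊆φ)
    (Fin.all? λ i → Fin.all? λ j → T? (Congruence.related θ (el i) (el j)) →-dec T? (Congruence.related φ (el i) (el j)))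

  -- Principal congruences.

  private
    module FiniteCon = FinitePoset Con _⊆?_ congruences-enumeration

  -- The intersection of all listed congruences that identify `x` and `y`; finiteness of the list
  -- makes it Boolean-valued.
  con : Carrier → Carrier → Congruence
  con x y = record
    { related       = λ u v → ⌊ In? u v ⌋
    ; ∼-resp-≈      = λ u≈v → fromWitness (All.universal (λ φ _ → Congruence.∼-resp-≈ φ u≈v) _)
    ; isEquivalence = record
      { refl  = λ {u} → fromWitness (All.universal (λ φ _ → IsEquivalence.refl (isEquivalence φ) {u}) _)
      ; sym   = λ {u} {v} u∼v → fromWitness (All.map (λ {φ} h xφy → IsEquivalence.sym (isEquivalence φ) (h xφy)) (toWitness {a? = In? u v} u∼v))
      ; trans = λ {u} {v} {w} u∼v v∼w → fromWitness (All.zipWith (λ {φ} (h , h′) xφy → IsEquivalence.trans (isEquivalence φ) (h xφy) (h′ xφy))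
                  (toWitness {a? = In? u v} u∼v , toWitness {a? = In? v w} v∼w))
      }
    ; ∨-cong = λ {u} {v} {s} {t} u∼v s∼t → fromWitness (All.zipWith (λ {φ} (h , h′) xφy → Congruence.∨-cong φ (h xφy) (h′ xφy))
                  (toWitness {a? = In? u v} u∼v , toWitness {a? = In? s t} s∼t))
    ; ∧-cong = λ {u} {v} {s} {t} u∼v s∼t → fromWitness (All.zipWith (λ {φ} (h , h′) xφy → Congruence.∧-cong φ (h xφy) (h′ xφy))
                  (toWitness {a? = In? u v} u∼v , toWitness {a? = In? s t} s∼t))
    }
    where
    open Congruence using (related; isEquivalence)
    In : Rel Carrier _
    In u v = All (λ φ → T (related φ x y) → T (related φ u v)) congruences
    In? : Decidable In
    In? u v = All.all? (λ φ → T? _ →-dec T? _) congruences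

  con-isCon : ∀ x y → IsCon x y (con x y)
  con-isCon x y =
      fromWitness (All.universal (λ _ → id) _)
    , λ φ xφy {(u , v)} u∼v → All.lookupWith
        (λ {ψ} h (φ⊆ψ , ψ⊆φ) → ψ⊆φ (h (φ⊆ψ xφy))) (toWitness u∼v) (congruences-enumeration φ)

  _∩_ : Congruence → Congruence → Congruence
  θ ∩ φ = record
    { related       = λ x y → θ.related x y Bool.∧ φ.related x y
    ; ∼-resp-≈      = λ x≈y → from T-∧ (θ.∼-resp-≈ x≈y , φ.∼-resp-≈ x≈y)
    ; isEquivalence = record
      { refl  = from T-∧ (IsEquivalence.refl θ.isEquivalence , IsEquivalence.refl φ.isEquivalence)
      ; sym   = λ p → let (pθ , pφ) = to T-∧ p in
          from T-∧ (IsEquivalence.sym θ.isEquivalence pθ , IsEquivalence.sym φ.isEquivalence pφ)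
      ; trans = λ p q → let (pθ , pφ) = to T-∧ p; (qθ , qφ) = to T-∧ q in
          from T-∧ (IsEquivalence.trans θ.isEquivalence pθ qθ , IsEquivalence.trans φ.isEquivalence pφ qφ)
      }
    ; ∨-cong = λ p q → let (pθ , pφ) = to T-∧ p; (qθ , qφ) = to T-∧ q in
        from T-∧ (θ.∨-cong pθ qθ , φ.∨-cong pφ qφ)
    ; ∧-cong = λ p q → let (pθ , pφ) = to T-∧ p; (qθ , qφ) = to T-∧ q in
        from T-∧ (θ.∧-cong pθ qθ , φ.∧-cong pφ qφ)
    }
    where
    open Equivalence
    module θ = Congruence θ
    module φ = Congruence φ

  conʲ : JoinIrreducible → Congruence
  conʲ j = con (lower j) (element j)

  conʲ-contracts : ∀ j → Contracts (conʲ j) j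
  conʲ-contracts j = proj₁ (con-isCon (lower j) (element j))

  conʲ-least : ∀ j φ → Contracts φ j → Poset._≤_ Con (conʲ j) φ
  conʲ-least j = proj₂ (con-isCon (lower j) (element j))

  -- Join-irreducibility of the congruence con(j₋ , j).

  module _ (j : JoinIrreducible) where
    private
      Forces : Pred JoinIrreducible _
      Forces k = Contracts (conʲ k) j

      -- This comparison sees only the join-irreducibles whose congruence contains con(j₋ , j). Its
      -- symmetric part will be the congruence `κ`.
      _⊑_ : Rel Carrier _
      x ⊑ y = ∀ k → Forces k → element k ≤ x → element k ≤ y

      _⊑ₗ_ : Rel Carrier _
      x ⊑ₗ y = All (λ k → Forces k → element k ≤ x → element k ≤ y) joinIrreducibles

      _⊑ₗ?_ : Decidable _⊑ₗ_
      x ⊑ₗ? y = All.all? (λ k → T? _ →-dec ((element k ≤? x) →-dec (element k ≤? y))) joinIrreducibles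

      ⊑ₗ⇒⊑ : ∀ {x y} → x ⊑ₗ y → x ⊑ y
      ⊑ₗ⇒⊑ x⊑y k forces k≤x = All.lookupWith
        (λ {k′} h k≈k′ → ≤-respˡ-≈ (Eq.sym k≈k′)
          (h (conʲ-least k (conʲ k′) (contracts-resp (conʲ k′) {k′} {k} (Eq.sym k≈k′) (conʲ-contracts k′)) forces)
             (≤-respˡ-≈ k≈k′ k≤x)))
        x⊑y (joinIrreducibles-complete k)

      _⊑?_ : Decidable _⊑_
      x ⊑? y = map′ ⊑ₗ⇒⊑ (λ x⊑y → All.universal x⊑y _) (x ⊑ₗ? y)

      ⊑-trans : Transitive _⊑_
      ⊑-trans x⊑y y⊑z k forces = y⊑z k forces ∘ x⊑y k forces

      ≤⇒⊑ : ∀ {x y} → x ≤ y → x ⊑ y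
      ≤⇒⊑ x≤y k _ k≤x = ≤-trans k≤x x≤y

      ∧-mono-⊑ : ∀ {x y u v} → x ⊑ y → u ⊑ v → (x ∧ u) ⊑ (y ∧ v)
      ∧-mono-⊑ x⊑y u⊑v k forces k≤x∧u = ∧-greatest
        (x⊑y k forces (≤-trans k≤x∧u (x∧y≤x _ _))) (u⊑v k forces (≤-trans k≤x∧u (x∧y≤y _ _)))

      -- Were k ≤ x ∨ z but k ≰ y ∨ z, take w maximal in [x ∧ y , x] with
      -- k ≰ w ∨ z.  A join-irreducible k′ ≤ x with k′ ≰ w and k′₋ ≤ w then
      -- forces k, hence j, so that k′ ≤ x ∧ y ≤ w.
      ∨-monoˡ-⊑ : ∀ {x y} z → x ⊑ y → (x ∨ z) ⊑ (y ∨ z)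
      ∨-monoˡ-⊑ {x} {y} z x⊑y k forces k≤x∨z = decidable-stable (_ ≤? _) λ k≰y∨z →
        let w , (w≤x , k≰w∨z) , x∧y≤w , max =
              maximal (λ w → (w ≤? x) ×-dec ¬? (element k ≤? (w ∨ z)))
                (λ u≈v (u≤x , k≰u∨z) → ≤-respˡ-≈ u≈v u≤x ,
                   k≰u∨z ∘ ≤-respʳ-≈ (∨-cong-≈ (Eq.sym u≈v) Eq.refl))
                (x∧y≤x x y , λ k≤ → k≰y∨z (≤-trans k≤ (∨-mono (x∧y≤y x y) ≤-refl)))
            k′ , k′≤x , k′≰w , k′₋≤w = separating {x} {w} (λ x≤w →
              k≰w∨z (≤-trans k≤x∨z (∨-mono x≤w ≤-refl)))
            θ = conʲ k′
            k≤ = decidable-stable (element k ≤? ((element k′ ∨ w) ∨ z)) λ k≰ →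
              k′≰w (≤-trans (x≤x∨y _ w) (max (element k′ ∨ w) (∨-least k′≤x w≤x , k≰) (y≤x∨y _ w)))
            kθ = separated⇒contracts θ k
              (∨-cong θ (IsEquivalence.sym (isEquivalence θ) (contracts⇒∼ θ k′ (conʲ-contracts k′) k′₋≤w))
                        (IsEquivalence.refl (isEquivalence θ) {z}))
              k≤ k≰w∨z
        in k′≰w (≤-trans (∧-greatest k′≤x (x⊑y k′ (conʲ-least k θ kθ forces) k′≤x)) x∧y≤w)
        where open Congruence using (isEquivalence; ∨-cong)

      ∨-mono-⊑ : ∀ {x y u v} → x ⊑ y → u ⊑ v → (x ∨ u) ⊑ (y ∨ v)
      ∨-mono-⊑ {x} {y} {u} {v} x⊑y u⊑v =
        ⊑-trans (∨-monoˡ-⊑ u x⊑y) (⊑-trans (≤⇒⊑ (≤-reflexive (∨-comm y u)))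
          (⊑-trans (∨-monoˡ-⊑ y u⊑v) (≤⇒⊑ (≤-reflexive (∨-comm v y)))))

      κ? : Decidable (λ x y → x ⊑ y × y ⊑ x)
      κ? x y = (x ⊑? y) ×-dec (y ⊑? x)

      -- The largest congruence that does not contract j: it contracts exactly
      -- the join-irreducibles k with con(j) ≰ con(k).
      κ : Congruence
      κ = record
        { related       = λ x y → ⌊ κ? x y ⌋
        ; ∼-resp-≈      = λ x≈y → fromWitness (≤⇒⊑ (≤-reflexive x≈y) , ≤⇒⊑ (≤-reflexive (Eq.sym x≈y)))
        ; isEquivalence = record
          { refl  = fromWitness (≤⇒⊑ ≤-refl , ≤⇒⊑ ≤-refl)
          ; sym   = λ x∼y → fromWitness (swap (κ⁻ x∼y))
          ; trans = λ x∼y y∼z →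
              let (x⊑y , y⊑x) = κ⁻ x∼y; (y⊑z , z⊑y) = κ⁻ y∼z in
              fromWitness (⊑-trans x⊑y y⊑z , ⊑-trans z⊑y y⊑x)
          }
        ; ∨-cong = λ x∼y u∼v →
            let (x⊑y , y⊑x) = κ⁻ x∼y; (u⊑v , v⊑u) = κ⁻ u∼v in
            fromWitness (∨-mono-⊑ x⊑y u⊑v , ∨-mono-⊑ y⊑x v⊑u)
        ; ∧-cong = λ x∼y u∼v →
            let (x⊑y , y⊑x) = κ⁻ x∼y; (u⊑v , v⊑u) = κ⁻ u∼v in
            fromWitness (∧-mono-⊑ x⊑y u⊑v , ∧-mono-⊑ y⊑x v⊑u)
        }
        where
        κ⁻ : ∀ {x y} → T ⌊ κ? x y ⌋ → x ⊑ y × y ⊑ x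
        κ⁻ = toWitness

      -- `j` forces itself, so `element j ⊑ lower j` would put `j` below `j₋`.
      κ-avoids : ¬ Contracts κ j
      κ-avoids jκ = ≰lower j (proj₂ (toWitness {a? = κ? _ _} jκ) j (conʲ-contracts j) ≤-refl)

      -- If `φ` relates `x` to `y` while some `k` forcing `j` is below `x` only, then `φ` contracts
      -- `k`, hence contains `conʲ k`, hence contracts `j`.
      κ-greatest : ∀ φ → ¬ Contracts φ j → Poset._≤_ Con φ κ
      κ-greatest φ jφ̸ {x , y} xφy = fromWitness {a? = κ? x y} (below xφy , below (IsEquivalence.sym isEquivalence xφy))
        where
        open Congruence φ
        below : ∀ {x y} → x ∼ y → x ⊑ y
        below x∼y k forces k≤x = decidable-stable (_ ≤? _) λ k≰y →
          jφ̸ (conʲ-least k φ (separated⇒contracts φ k x∼y k≤x k≰y) forces)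

    -- A congruence strictly below `conʲ j` cannot contract `j`, so it lies below `κ`. Therefore
    -- `conʲ j ∩ κ` is the greatest one.
    con-joinIrreducible : Con.JoinIrreducible
    con-joinIrreducible =
      fromGreatestBelow Con (λ {θ} {φ} → decidable-stable (θ ⊆? φ)) (conʲ j) (conʲ j ∩ κ)
        (proj₁ ∘ ∩⁻) (λ j⊆ → κ-avoids (proj₂ (∩⁻ (j⊆ (conʲ-contracts j)))))
        (λ φ φ⊆j j⊈φ uφv → Equivalence.from T-∧
          (φ⊆j uφv , κ-greatest φ (λ jφ → j⊈φ (conʲ-least j φ jφ)) uφv))
      where
      ∩⁻ : ∀ {b b′} → T (b Bool.∧ b′) → T b × T b′
      ∩⁻ = Equivalence.to T-∧

  -- A join-irreducible `j` contracted by `θ` but not by its lower cover `θ₋` gives a congruence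
  -- `conʲ j` below `θ` and not below `θ₋`, which must be `θ`.
  conʲ-surjective : ∀ (Θ : Con.JoinIrreducible) →
    Σ[ j ∈ JoinIrreducible ] Poset._≈_ Con (conʲ j) (Con.JoinIrreducible.element Θ)
  conʲ-surjective Θ = let j , jθ , jθ̸₋ = contracted in j , (λ {p} → conʲ-least j θ jθ {p}) , (λ {p} →
    decidable-stable (θ ⊆? conʲ j) (λ θ⊈j →
      jθ̸₋ (FiniteCon.strictlyBelow⇒≤lower Θ {conʲ j} (λ {p} → conʲ-least j θ jθ {p}) θ⊈j (conʲ-contracts j))) {p})
    where
    open Con.JoinIrreducible Θ renaming (element to θ; lower to θ₋)
    module θ = Congruence θ
    module θ₋ = Congruence θ₋
    module ∼ = IsEquivalence θ.isEquivalence
    module ∼₋ = IsEquivalence θ₋.isEquivalence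

    -- Go up from `y` inside its `θ₋`-class to a maximal `w ≤ x`, and let `j` separate `x` from `w`.
    -- Contracting `j` in `θ₋` would relate `w` to the larger element `element j ∨ w`.
    contractedByθ : ∀ {x y} → y ≤ x → x θ.∼ y → ¬ (x θ₋.∼ y) →
                    Σ[ j ∈ JoinIrreducible ] Contracts θ j × ¬ Contracts θ₋ j
    contractedByθ {x} {y} y≤x xθy xθ̸₋y =
      let w , (w≤x , wθ₋y) , y≤w , max =
            maximal (λ w → (w ≤? x) ×-dec T? (θ₋.related w y))
              (λ u≈v (u≤x , u∼y) → ≤-respˡ-≈ u≈v u≤x , ∼-resp θ₋ u≈v Eq.refl u∼y) (y≤x , ∼₋.refl)
          j , j≤x , j≰w , j₋≤w = separating {x} {w} (λ x≤w →
            xθ̸₋y (∼-resp θ₋ (antisym w≤x x≤w) Eq.refl wθ₋y))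
          xθw = ∼-resp θ (Eq.trans (∨-comm x w) (x≤y⇒x∨y≈y w≤x)) (x≤y⇒x∨y≈y y≤w)
                  (θ.∨-cong xθy (∼.refl {w}))
      in j , separated⇒contracts θ j xθw j≤x j≰w , λ jθ₋ →
           j≰w (≤-trans (x≤x∨y _ w) (max (element j ∨ w)
             (∨-least j≤x w≤x , ∼₋.trans (∼₋.sym (contracts⇒∼ θ₋ j jθ₋ j₋≤w)) wθ₋y) (y≤x∨y _ w)))

    contracted : Σ[ j ∈ JoinIrreducible ] Contracts θ j × ¬ Contracts θ₋ j
    contracted with Fin.any? (λ i → Fin.any? λ k → T? (θ.related (el i) (el k)) ×-dec ¬? (T? (θ₋.related (el i) (el k))))
    ... | no ∄ = contradiction
          (λ {(x , y)} xθy → ∼-resp θ₋ (Eq.sym (el-idx x)) (Eq.sym (el-idx y))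
            (decidable-stable (T? _) λ xθ̸₋y → ∄ (idx x , idx y , ∼-resp θ (el-idx x) (el-idx y) xθy , xθ̸₋y)))
          (FiniteCon.≰lower Θ)
    -- The pair is replaced by a comparable one: if `θ₋` related both elements to their meet, it
    -- would relate them to each other.
    ... | yes (i , k , iθk , iθ̸₋k) with T? (θ₋.related (el i) (el i ∧ el k))
    ... | no  iθ̸₋i∧k = contractedByθ (x∧y≤x _ _)
          (∼-resp θ (x≤y⇒x∧y≈x ≤-refl) Eq.refl (θ.∧-cong (∼.refl {el i}) iθk)) iθ̸₋i∧k
    ... | yes iθ₋i∧k = contractedByθ (x∧y≤y (el i) (el k))
          (∼-resp θ (x≤y⇒x∧y≈x ≤-refl) Eq.refl (θ.∧-cong (∼.sym iθk) (∼.refl {el k})))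
          (λ kθ₋i∧k → iθ̸₋k (∼₋.trans iθ₋i∧k (∼₋.sym kθ₋i∧k)))

  -- The hypothesis is injectivity in disguise: `conʲ j` and `conʲ k` coincide exactly when the same
  -- congruences contract `j` and `k`.
  con-bijection : (∀ j k → (∀ θ → Contracts θ j ⇔ Contracts θ k) → j ≈ʲ k) →
    Σ[ f ∈ (JoinIrreducible → Con.JoinIrreducible) ]
      (∀ j → IsCon (lower j) (element j) (Con.JoinIrreducible.element (f j))) ×
      Bijective _≈ʲ_ Con._≈ʲ_ f
  con-bijection separated = con-joinIrreducible , (λ j → con-isCon (lower j) (element j)) ,
    (λ {j} {k} (j⊆k , k⊆j) → separated j k λ θ →
      mk⇔ (λ jθ → conʲ-least j θ jθ (k⊆j (conʲ-contracts k)))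
          (λ kθ → conʲ-least k θ kθ (j⊆k (conʲ-contracts j)))) ,
    λ Θ → let j , (j⊆Θ , Θ⊆j) = conʲ-surjective Θ in
      j , λ {k} k≈j →
        (λ {p} kp → j⊆Θ (conʲ-least k (conʲ j) (contracts-resp (conʲ j) {j} {k} (Eq.sym k≈j) (conʲ-contracts j)) {p} kp)) ,
        (λ {p} Θp → conʲ-least j (conʲ k) (contracts-resp (conʲ k) {k} {j} k≈j (conʲ-contracts k)) {p} (Θ⊆j Θp))

-- Lattices with an order-reversing involution.

module _ (P : Poset c ℓ₁ ℓ₂) where
  open Poset P
  open Irreducibles P

  ⋖-resp : ∀ {x x′ y y′} → x ≈ x′ → y ≈ y′ → x ⋖ y → x′ ⋖ y′
  ⋖-resp x≈x′ y≈y′ ((x≤y , x≉y) , nothingBetween) =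
    (≤-respʳ-≈ y≈y′ (≤-respˡ-≈ x≈x′ x≤y) , λ x′≈y′ → x≉y (Eq.trans x≈x′ (Eq.trans x′≈y′ (Eq.sym y≈y′)))) ,
    λ z ((x′≤z , x′≉z) , (z≤y′ , z≉y′)) → nothingBetween z
      ((≤-respˡ-≈ (Eq.sym x≈x′) x′≤z , x′≉z ∘ Eq.trans (Eq.sym x≈x′)) ,
       (≤-respʳ-≈ (Eq.sym y≈y′) z≤y′ , λ z≈y → z≉y′ (Eq.trans z≈y y≈y′)))

module SelfDual (L : Lattice c ℓ₁ ℓ₂) (∁ : Op₁ (Lattice.Carrier L))
                (∁-anti : ∀ {x y} → Lattice._≤_ L x y → Lattice._≤_ L (∁ y) (∁ x))
                (∁-involutive : ∀ x → Lattice._≈_ L (∁ (∁ x)) x) where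
  open Lattice L hiding (isEquivalence) renaming (trans to ≤-trans; reflexive to ≤-reflexive)
  open Irreducibles poset
  open Congruences L
  open Congruence using (related; ∼-resp-≈; isEquivalence)
  module Con = Irreducibles Con

  private
    infix 4 _⊆_
    _⊆_ = Poset._≤_ Con

    ∁-cong : ∀ {x y} → x ≈ y → ∁ x ≈ ∁ y
    ∁-cong x≈y = antisym (∁-anti (≤-reflexive (Eq.sym x≈y))) (∁-anti (≤-reflexive x≈y))

    ∁-injective : ∀ {x y} → ∁ x ≈ ∁ y → x ≈ y
    ∁-injective ∁x≈∁y = Eq.trans (Eq.sym (∁-involutive _)) (Eq.trans (∁-cong ∁x≈∁y) (∁-involutive _))

    ∁-swapˡ : ∀ {x y} → ∁ x ≤ y → ∁ y ≤ x
    ∁-swapˡ ∁x≤y = ≤-respʳ-≈ (∁-involutive _) (∁-anti ∁x≤y)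

    ∁-swapʳ : ∀ {x y} → x ≤ ∁ y → y ≤ ∁ x
    ∁-swapʳ x≤∁y = ≤-respˡ-≈ (∁-involutive _) (∁-anti x≤∁y)

    ∁-≈-swap : ∀ {x y} → ∁ x ≈ y → x ≈ ∁ y
    ∁-≈-swap ∁x≈y = Eq.trans (Eq.sym (∁-involutive _)) (∁-cong ∁x≈y)

    ∁-⋖ : ∀ {x y} → x ⋖ y → ∁ y ⋖ ∁ x
    ∁-⋖ ((x≤y , x≉y) , nothingBetween) = (∁-anti x≤y , x≉y ∘ ∁-injective ∘ Eq.sym) ,
      λ z ((∁y≤z , ∁y≉z) , (z≤∁x , z≉∁x)) → nothingBetween (∁ z)
        ((∁-swapʳ z≤∁x , λ x≈∁z → z≉∁x (∁-≈-swap (Eq.sym x≈∁z))) ,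
         (∁-swapˡ ∁y≤z , λ ∁z≈y → ∁y≉z (Eq.sym (∁-≈-swap ∁z≈y))))

    toJoin : MeetIrreducible → JoinIrreducible
    toJoin m = record
      { element = ∁ element
      ; lower   = ∁ upper
      ; covers  = ∁-⋖ covered
      ; unique  = λ y⋖∁m → ∁-≈-swap (unique (⋖-resp poset (∁-involutive _) Eq.refl (∁-⋖ y⋖∁m)))
      }
      where open MeetIrreducible m

    toMeet : JoinIrreducible → MeetIrreducible
    toMeet j = record
      { element = ∁ element
      ; upper   = ∁ lower
      ; covered = ∁-⋖ covers
      ; unique  = λ ∁j⋖y → ∁-≈-swap (unique (⋖-resp poset Eq.refl (∁-involutive _) (∁-⋖ ∁j⋖y)))
      }
      where open JoinIrreducible j

    ∁-∨ : ∀ x y → ∁ (x ∨ y) ≈ ∁ x ∧ ∁ y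
    ∁-∨ x y = antisym (∧-greatest (∁-anti (x≤x∨y x y)) (∁-anti (y≤x∨y x y)))
      (∁-swapʳ (∨-least (∁-swapʳ (x∧y≤x _ _)) (∁-swapʳ (x∧y≤y _ _))))

    ∁-∧ : ∀ x y → ∁ (x ∧ y) ≈ ∁ x ∨ ∁ y
    ∁-∧ x y = antisym (∁-swapˡ (∧-greatest (∁-swapˡ (x≤x∨y _ _)) (∁-swapˡ (y≤x∨y _ _))))
      (∨-least (∁-anti (x∧y≤x x y)) (∁-anti (x∧y≤y x y)))

    resp : ∀ θ {x x′ y y′} → x ≈ x′ → y ≈ y′ → T (related θ x y) → T (related θ x′ y′)
    resp θ x≈x′ y≈y′ x∼y = ∼.trans (∼-resp-≈ θ (Eq.sym x≈x′)) (∼.trans x∼y (∼-resp-≈ θ y≈y′))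
      where module ∼ = IsEquivalence (isEquivalence θ)

    -- The pullback along `∁` is again a congruence because the De Morgan laws exchange its
    -- compatibility with joins and with meets.
    dual : Congruence → Congruence
    dual θ = record
      { related       = related θ on ∁
      ; ∼-resp-≈      = ∼-resp-≈ θ ∘ ∁-cong
      ; isEquivalence = record
        { refl  = IsEquivalence.refl (isEquivalence θ)
        ; sym   = IsEquivalence.sym (isEquivalence θ)
        ; trans = IsEquivalence.trans (isEquivalence θ)
        }
      ; ∨-cong = λ p q → resp θ (Eq.sym (∁-∨ _ _)) (Eq.sym (∁-∨ _ _)) (Congruence.∧-cong θ p q)
      ; ∧-cong = λ p q → resp θ (Eq.sym (∁-∧ _ _)) (Eq.sym (∁-∧ _ _)) (Congruence.∨-cong θ p q)
      }

    dual-mono : ∀ θ φ → θ ⊆ φ → dual θ ⊆ dual φ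
    dual-mono θ φ θ⊆φ p = θ⊆φ p

    dual-swapʳ : ∀ θ φ → dual θ ⊆ φ → θ ⊆ dual φ
    dual-swapʳ θ φ θ′⊆φ p = θ′⊆φ (resp θ (Eq.sym (∁-involutive _)) (Eq.sym (∁-involutive _)) p)

    dual-swapˡ : ∀ θ φ → θ ⊆ dual φ → dual θ ⊆ φ
    dual-swapˡ θ φ θ⊆φ′ p = resp φ (∁-involutive _) (∁-involutive _) (θ⊆φ′ p)

    dual-involutive : ∀ θ → Poset._≈_ Con (dual (dual θ)) θ
    dual-involutive θ = dual-swapˡ (dual θ) θ id , dual-swapʳ θ (dual θ) id

    dual-reflects : ∀ θ φ → dual θ ⊆ dual φ → θ ⊆ φ
    dual-reflects θ φ θ′⊆φ′ {x , y} p = resp φ (∁-involutive _) (∁-involutive _)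
      (θ′⊆φ′ {∁ x , ∁ y} (resp θ (Eq.sym (∁-involutive _)) (Eq.sym (∁-involutive _)) p))

    dual-⋖ : ∀ θ φ → θ Con.⋖ φ → dual θ Con.⋖ dual φ
    dual-⋖ θ φ ((θ⊆φ , θ≉φ) , nothingBetween) =
      (dual-mono θ φ θ⊆φ , λ (θ⊆φ , φ⊆θ) → θ≉φ (dual-reflects θ φ θ⊆φ , dual-reflects φ θ φ⊆θ)) ,
      λ ψ ((θ⊆ψ , θ≉ψ) , (ψ⊆φ , ψ≉φ)) → nothingBetween (dual ψ)
        ((dual-swapʳ θ ψ θ⊆ψ , λ (_ , ψ⊆θ) → θ≉ψ (θ⊆ψ , dual-swapʳ ψ θ ψ⊆θ)) ,
         (dual-swapˡ ψ φ ψ⊆φ , λ (_ , φ⊆ψ) → ψ≉φ (ψ⊆φ , dual-swapˡ φ ψ φ⊆ψ)))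

    dualʲ : Con.JoinIrreducible → Con.JoinIrreducible
    dualʲ Θ = record
      { element = dual element
      ; lower   = dual lower
      ; covers  = dual-⋖ lower element covers
      ; unique  = λ {φ} φ⋖θ →
          let (φ⊆ , ⊆φ) = unique {dual φ} (⋖-resp Con {dual φ} {dual φ} {dual (dual element)} {element}
                                    (Poset.Eq.refl Con {dual φ}) (dual-involutive element)
                                    (dual-⋖ φ (dual element) φ⋖θ))
          in dual-swapʳ φ lower φ⊆ , dual-swapˡ lower φ ⊆φ
      }
      where open Con.JoinIrreducible Θ

  open MeetIrreducible
  open Con.JoinIrreducible using () renaming (element to congruence)

  -- With m^⋆ the upper cover of m, con(m , m^⋆) is the dual of con(∁ m^⋆ , ∁ m). The map is thus
  -- `f` conjugated by two correspondences that are invertible up to equivalence.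
  meetBijection :
    Σ[ f ∈ (JoinIrreducible → Con.JoinIrreducible) ]
      (∀ j → IsCon (JoinIrreducible.lower j) (JoinIrreducible.element j) (congruence (f j))) ×
      Bijective _≈ʲ_ Con._≈ʲ_ f →
    Σ[ f ∈ (MeetIrreducible → Con.JoinIrreducible) ]
      (∀ m → IsCon (element m) (upper m) (congruence (f m))) ×
      Bijective _≈ᵐ_ Con._≈ʲ_ f
  meetBijection (f , isCon , f-injective , f-surjective) =
    dualʲ ∘ f ∘ toJoin ,
    (λ m → let θ = congruence (f (toJoin m)); (mθ , least) = isCon (toJoin m) in
      IsEquivalence.sym (isEquivalence θ) mθ , λ φ mφ →
        dual-swapˡ θ φ (least (dual φ) (resp φ (Eq.sym (∁-involutive _)) (Eq.sym (∁-involutive _))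
          (IsEquivalence.sym (isEquivalence φ) mφ)))) ,
    (λ {m} {m′} (⊆₁ , ⊆₂) →
      let θ = congruence (f (toJoin m)); θ′ = congruence (f (toJoin m′)) in
      ∁-injective (f-injective {toJoin m} {toJoin m′} (dual-reflects θ θ′ ⊆₁ , dual-reflects θ′ θ ⊆₂))) ,
    λ Θ → let j , fj≈ = f-surjective (dualʲ Θ) in
      toMeet j , λ {m} m≈∁j →
        let θ = congruence (f (toJoin m))
            (⊆₁ , ⊆₂) = fj≈ {toJoin m} (Eq.trans (∁-cong m≈∁j) (∁-involutive _))
        in dual-swapˡ θ (congruence Θ) ⊆₁ , dual-swapʳ (congruence Θ) θ ⊆₂

-- Cuts and factors of lists.

module _ {A : Set} where

  compare-++-∷ : ∀ xs xs′ {x x′ : A} {ys ys′} → xs ++ x ∷ ys ≡ xs′ ++ x′ ∷ ys′ →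
    (xs ≡ xs′ × x ≡ x′ × ys ≡ ys′) ⊎
    (∃ λ zs → xs′ ≡ xs ++ x ∷ zs × ys ≡ zs ++ x′ ∷ ys′) ⊎
    (∃ λ zs → xs ≡ xs′ ++ x′ ∷ zs × ys′ ≡ zs ++ x ∷ ys)
  compare-++-∷ []       []         refl = inj₁ (refl , refl , refl)
  compare-++-∷ []       (x′ ∷ xs′) refl = inj₂ (inj₁ (xs′ , refl , refl))
  compare-++-∷ (x ∷ xs) []         refl = inj₂ (inj₂ (xs , refl , refl))
  compare-++-∷ (x ∷ xs) (x′ ∷ xs′) eq with refl , eq′ ← List.∷-injective eq =
    Sum.map (λ (p , q) → cong (x ∷_) p , q)
            (Sum.map (λ (zs , p , q) → zs , cong (x ∷_) p , q) (λ (zs , p , q) → zs , cong (x ∷_) p , q))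
            (compare-++-∷ xs xs′ eq′)

  module _ {R : A → A → Set} where

    linked-++⁻ˡ : ∀ xs {ys} → Linked R (xs ++ ys) → Linked R xs
    linked-++⁻ˡ []           _        = []
    linked-++⁻ˡ (x ∷ [])     _        = [-]
    linked-++⁻ˡ (x ∷ y ∷ xs) (r ∷ rs) = r ∷ linked-++⁻ˡ (y ∷ xs) rs

    linked-++⁻ʳ : ∀ xs {ys} → Linked R (xs ++ ys) → Linked R ys
    linked-++⁻ʳ []           rs       = rs
    linked-++⁻ʳ (x ∷ [])     [-]      = []
    linked-++⁻ʳ (x ∷ [])     (_ ∷ rs) = rs
    linked-++⁻ʳ (x ∷ y ∷ xs) (_ ∷ rs) = linked-++⁻ʳ (y ∷ xs) rs

-- Splittings of strings

module Splitting (Q : BoundQuiver) where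
  open BoundQuiver Q
  open Strings Q renaming (_∘_ to _∘ᴾ_; Bicl to BiclQ) hiding (FinitelyManyStrings)
  open IsString

  infix 4 _≃_
  _≃_ : String → String → Set
  σ ≃ τ = underlying σ ≈± underlying τ

  st : String → Vertex
  st = start ∘ underlying

  ls : String → List Letter
  ls = letters ∘ underlying

  len : String → ℕ
  len = length ∘ ls

  flip-involutive : ∀ ℓ → flip (flip ℓ) ≡ ℓ
  flip-involutive (α , Sign.+) = refl
  flip-involutive (α , Sign.-) = refl

  tgt-flip : ∀ ℓ → tgt (flip ℓ) ≡ src ℓ
  tgt-flip (α , Sign.+) = refl
  tgt-flip (α , Sign.-) = refl

  flips-++-∷ : ∀ xs ℓ ys → flips (xs ++ ℓ ∷ ys) ≡ flips ys ++ flip ℓ ∷ flips xs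
  flips-++-∷ xs ℓ ys = begin
    reverse (map flip (xs ++ ℓ ∷ ys))            ≡⟨ cong reverse (List.map-++ flip xs (ℓ ∷ ys)) ⟩
    reverse (map flip xs ++ flip ℓ ∷ map flip ys) ≡⟨ List.reverse-++ (map flip xs) (flip ℓ ∷ map flip ys) ⟩
    reverse (flip ℓ ∷ map flip ys) ++ flips xs   ≡⟨ cong (_++ flips xs) (List.unfold-reverse (flip ℓ) (map flip ys)) ⟩
    (flips ys ∷ʳ flip ℓ) ++ flips xs             ≡⟨ List.++-assoc (flips ys) [ flip ℓ ] (flips xs) ⟩
    flips ys ++ flip ℓ ∷ flips xs                ∎
    where open ≡-Reasoning

  flips-involutive : ∀ xs → flips (flips xs) ≡ xs
  flips-involutive xs = begin
    reverse (map flip (reverse (map flip xs))) ≡⟨ cong reverse (List.reverse-map flip (map flip xs)) ⟩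
    reverse (reverse (map flip (map flip xs))) ≡⟨ List.reverse-involutive _ ⟩
    map flip (map flip xs)                     ≡⟨ List.map-∘ xs ⟨
    map (flip ∘ flip) xs                       ≡⟨ List.map-cong flip-involutive xs ⟩
    map id xs                                  ≡⟨ List.map-id xs ⟩
    xs                                         ∎
    where open ≡-Reasoning

  end-++-∷ : ∀ v xs ℓ ys → end (word v (xs ++ ℓ ∷ ys)) ≡ end (word (tgt ℓ) ys)
  end-++-∷ v xs ℓ ys = List.foldl-++ (λ _ → tgt) v xs (ℓ ∷ ys)

  -- Inverting a nonempty word twice recovers the source of its first letter, which composability
  -- identifies with the recorded start.
  ⁻¹-involutive : ∀ w → Composable (start w) (letters w) → (w ⁻¹) ⁻¹ ≡ w
  ⁻¹-involutive w comp = cong₂ word (end-⁻¹ w comp) (flips-involutive (letters w))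
    where
    end-⁻¹ : ∀ w → Composable (start w) (letters w) → end (w ⁻¹) ≡ start w
    end-⁻¹ (word v [])       _          = refl
    end-⁻¹ (word v (ℓ ∷ xs)) (src≡ , _) = begin
      end (word _ (flips (ℓ ∷ xs)))      ≡⟨ cong (end ∘ word _) (flips-++-∷ [] ℓ xs) ⟩
      end (word _ (flips xs ∷ʳ flip ℓ))  ≡⟨ end-++-∷ _ (flips xs) (flip ℓ) [] ⟩
      tgt (flip ℓ)                       ≡⟨ tgt-flip ℓ ⟩
      src ℓ                              ≡⟨ src≡ ⟩
      v                                  ∎
      where open ≡-Reasoning

  ⁻¹-≈± : ∀ {w} σ → w ≈± underlying σ → (w ⁻¹) ≈± underlying σ
  ⁻¹-≈± σ (inj₁ eq) = inj₂ (cong _⁻¹ eq)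
  ⁻¹-≈± σ (inj₂ eq) = inj₁ (trans (cong _⁻¹ eq) (⁻¹-involutive _ (composable (isString σ))))

  ≃-sym : ∀ σ τ → σ ≃ τ → τ ≃ σ
  ≃-sym σ τ (inj₁ eq) = inj₁ (sym eq)
  ≃-sym σ τ (inj₂ eq) = inj₂ (sym (trans (cong _⁻¹ eq) (⁻¹-involutive _ (composable (isString τ)))))

  composable-++⁻ˡ : ∀ v xs {ys} → Composable v (xs ++ ys) → Composable v xs
  composable-++⁻ˡ v []       _            = _
  composable-++⁻ˡ v (ℓ ∷ xs) (src≡ , comp) = src≡ , composable-++⁻ˡ (tgt ℓ) xs comp

  composable-++⁻ʳ : ∀ v xs {ys} → Composable v (xs ++ ys) → Composable (end (word v xs)) ys
  composable-++⁻ʳ v []       comp       = comp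
  composable-++⁻ʳ v (ℓ ∷ xs) (_ , comp) = composable-++⁻ʳ (tgt ℓ) xs comp

  prefix : ∀ ρ xs {ys} → ls ρ ≡ xs ++ ys → String
  prefix ρ xs eq = record
    { underlying = word (st ρ) xs
    ; isString   = record
      { composable = composable-++⁻ˡ (st ρ) xs (subst (Composable (st ρ)) eq (composable ρ-string))
      ; reduced    = linked-++⁻ˡ xs (subst (Linked _) eq (reduced ρ-string))
      ; avoids-I   = λ π π∈I inf → avoids-I ρ-string π π∈I (subst (Infix-of _) (sym eq) (inf ⁱ++ _))
      ; avoids-I⁻¹ = λ π π∈I inf → avoids-I⁻¹ ρ-string π π∈I (subst (Infix-of _) (sym eq) (inf ⁱ++ _))
      }
    }
    where
    ρ-string = isString ρ
    Infix-of = Infix _≡_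

  suffix : ∀ ρ xs ℓ {ys} → ls ρ ≡ xs ++ ℓ ∷ ys → String
  suffix ρ xs ℓ {ys} eq = record
    { underlying = word (tgt ℓ) ys
    ; isString   = record
      { composable = proj₂ (composable-++⁻ʳ (st ρ) xs (subst (Composable (st ρ)) eq (composable ρ-string)))
      ; reduced    = linked-++⁻ʳ [ ℓ ] (linked-++⁻ʳ xs (subst (Linked _) eq (reduced ρ-string)))
      ; avoids-I   = λ π π∈I inf → avoids-I ρ-string π π∈I (subst (Infix-of _) (sym eq) (xs ++ⁱ there inf))
      ; avoids-I⁻¹ = λ π π∈I inf → avoids-I⁻¹ ρ-string π π∈I (subst (Infix-of _) (sym eq) (xs ++ⁱ there inf))
      }
    }
    where
    ρ-string = isString ρ
    Infix-of = Infix _≡_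

  -- A cut of `ρ` at one letter, with all orientations fixed, unlike in `_∘ˢ_`. That `σ` ends at the
  -- source of the letter follows from composability of `ρ`, see `end-left`.
  record Split (ρ σ τ : String) : Set where
    constructor split
    field
      letter      : Letter
      start-left  : st ρ ≡ st σ
      start-right : tgt letter ≡ st τ
      letters-≡   : ls ρ ≡ ls σ ++ letter ∷ ls τ

  module _ {ρ σ τ} (s : Split ρ σ τ) where
    open Split s

    end-left : end (underlying σ) ≡ src letter
    end-left = sym (proj₁ (composable-++⁻ʳ (st σ) (ls σ)
      (subst (Composable (st σ)) letters-≡ (subst (λ v → Composable v (ls ρ)) start-left (composable (isString ρ))))))

    end-right : end (underlying ρ) ≡ end (underlying τ)
    end-right = trans (cong (λ xs → end (word (st ρ) xs)) letters-≡)
      (trans (end-++-∷ (st ρ) (ls σ) letter (ls τ)) (cong (λ v → end (word v (ls τ))) start-right))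

    private
      len≡ : len ρ ≡ len σ + suc (len τ)
      len≡ = trans (cong length letters-≡) (List.length-++ (ls σ))

    left-shorter : len σ < len ρ
    left-shorter = ℕ.≤-trans (ℕ.m<m+n (len σ) (s≤s z≤n)) (ℕ.≤-reflexive (sym len≡))

    right-shorter : len τ < len ρ
    right-shorter = ℕ.≤-trans (ℕ.m≤n+m (suc (len τ)) (len σ)) (ℕ.≤-reflexive (sym len≡))

  splitAt : ∀ ρ xs ℓ ys → ls ρ ≡ xs ++ ℓ ∷ ys →
    ∃₂ λ σ τ → Split ρ σ τ × underlying σ ≡ word (st ρ) xs × underlying τ ≡ word (tgt ℓ) ys
  splitAt ρ xs ℓ ys eq = prefix ρ xs eq , suffix ρ xs ℓ eq , split ℓ refl refl eq , refl , refl

  -- The regrouped piece is a factor of `ρ`, hence a string.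
  split-assocʳ : ∀ {ρ σ τ σ₁ σ₂} → Split ρ σ τ → Split σ σ₁ σ₂ → ∃ λ υ → Split ρ σ₁ υ × Split υ σ₂ τ
  split-assocʳ {ρ} {σ} {τ} {σ₁} {σ₂} (split ℓ st₁ st₂ eq) (split ℓ′ st₁′ st₂′ eq′) =
    suffix ρ (ls σ₁) ℓ′ ρ≡ , split ℓ′ (trans st₁ st₁′) refl ρ≡ , split ℓ st₂′ st₂ refl
    where
    ρ≡ : ls ρ ≡ ls σ₁ ++ ℓ′ ∷ ls σ₂ ++ ℓ ∷ ls τ
    ρ≡ = trans eq (trans (cong (_++ ℓ ∷ ls τ) eq′) (List.++-assoc (ls σ₁) (ℓ′ ∷ ls σ₂) (ℓ ∷ ls τ)))

  split-assocˡ : ∀ {ρ σ τ τ₁ τ₂} → Split ρ σ τ → Split τ τ₁ τ₂ → ∃ λ υ → Split ρ υ τ₂ × Split υ σ τ₁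
  split-assocˡ {ρ} {σ} {τ} {τ₁} {τ₂} (split ℓ st₁ st₂ eq) (split ℓ′ st₁′ st₂′ eq′) =
    prefix ρ (ls σ ++ ℓ ∷ ls τ₁) ρ≡ , split ℓ′ refl st₂′ ρ≡ , split ℓ st₁ (trans st₂ st₁′) refl
    where
    ρ≡ : ls ρ ≡ (ls σ ++ ℓ ∷ ls τ₁) ++ ℓ′ ∷ ls τ₂
    ρ≡ = trans eq (trans (cong (λ xs → ls σ ++ ℓ ∷ xs) eq′) (sym (List.++-assoc (ls σ) (ℓ ∷ ls τ₁) (ℓ′ ∷ ls τ₂))))

  compareSplits : ∀ {ρ σ τ σ′ τ′} → Split ρ σ τ → Split ρ σ′ τ′ →
    (underlying σ ≡ underlying σ′ × underlying τ ≡ underlying τ′) ⊎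
    (∃ λ υ → Split σ′ σ υ × Split τ υ τ′) ⊎
    (∃ λ υ → Split σ σ′ υ × Split τ′ υ τ)
  compareSplits {σ = σ} {σ′ = σ′} (split ℓ st₁ st₂ eq) (split ℓ′ st₁′ st₂′ eq′)
    with compare-++-∷ (ls σ) (ls σ′) (trans (sym eq) eq′)
  ... | inj₁ (p , refl , q) = inj₁ (cong₂ word (trans (sym st₁) st₁′) p , cong₂ word (trans (sym st₂) st₂′) q)
  ... | inj₂ (inj₁ (zs , p , q)) = inj₂ (inj₁
        (suffix σ′ (ls σ) ℓ p , split ℓ (trans (sym st₁′) st₁) refl p , split ℓ′ (sym st₂) st₂′ q))
  ... | inj₂ (inj₂ (zs , p , q)) = inj₂ (inj₂
        (suffix σ (ls σ′) ℓ′ p , split ℓ′ (trans (sym st₁) st₁′) refl p , split ℓ (sym st₂′) st₂ q))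

  -- Passing to the inverse of `ρ` inverts both halves and exchanges them, whence the two
  -- alternatives.
  split-≃ : ∀ {ρ ρ′ σ τ} → ρ′ ≃ ρ → Split ρ σ τ →
    ∃₂ λ σ′ τ′ → σ′ ≃ σ × τ′ ≃ τ × (Split ρ′ σ′ τ′ ⊎ Split ρ′ τ′ σ′)
  split-≃ {σ = σ} {τ} (inj₁ eq) (split ℓ st₁ st₂ eq′) =
    σ , τ , inj₁ refl , inj₁ refl , inj₁ (split ℓ (trans (cong start eq) st₁) st₂ (trans (cong letters eq) eq′))
  split-≃ {ρ} {ρ′} {σ} {τ} (inj₂ eq) s@(split ℓ st₁ st₂ eq′)
    with τ′ , σ′ , s′ , τ′≡ , σ′≡ ← splitAt ρ′ (flips (ls τ)) (flip ℓ) (flips (ls σ))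
           (trans (cong letters eq) (trans (cong flips eq′) (flips-++-∷ (ls σ) ℓ (ls τ)))) =
    σ′ , τ′ ,
    inj₂ (trans σ′≡ (cong (λ v → word v (flips (ls σ))) (trans (tgt-flip ℓ) (sym (end-left s))))) ,
    inj₂ (trans τ′≡ (cong (λ v → word v (flips (ls τ))) (trans (cong start eq) (end-right s)))) ,
    inj₂ s′

  -- A binary, oriented form of closedness. For sets invariant under inversion it is equivalent to
  -- `Closed`.
  SplitClosed : Pred (Pred String 0ℓ) 0ℓ
  SplitClosed S = ∀ {ρ σ τ} → Split ρ σ τ → S σ → S τ → S ρ

  Closed⇒SplitClosed : ∀ {S} → Closed S → SplitClosed S
  Closed⇒SplitClosed (closure⊆S , _) {ρ} {σ} {τ} s@(split ℓ st₁ st₂ eq) σ∈S τ∈S =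
    closure⊆S (σ , τ ∷ [] , σ∈S ∷ τ∈S ∷ [] , σ , τ , inj₁ refl , inj₁ refl ,
      underlying σ , ℓ , underlying τ , inj₁ refl , inj₁ refl , end-left s , st₂ , inj₁ (cong₂ word st₁ eq))

  module _ {S : Pred String 0ℓ} (resp : ∀ {σ τ} → σ ≃ τ → S σ → S τ) (closed : SplitClosed S) where

    private
      resp′ : ∀ {σ τ} → τ ≃ σ → S σ → S τ
      resp′ {σ} {τ} τ≃σ = resp (≃-sym τ σ τ≃σ)

      ∘ˢ-closed : ∀ {ρ σ τ} → S σ → S τ → (σ ∘ˢ τ) ρ → S ρ
      ∘ˢ-closed {ρ} {σ} {τ} σ∈S τ∈S (σ′ , ℓ , τ′ , σ′≃σ , τ′≃τ , end≡ , tgt≡ , inj₁ eq)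
        with σ₁ , τ₁ , s , σ₁≡ , τ₁≡ ← splitAt ρ (letters σ′) ℓ (letters τ′) (cong letters eq) =
        closed s
          (resp′ (subst (_≈± underlying σ) (sym (trans σ₁≡ (cong (λ v → word v (letters σ′)) (cong start eq)))) σ′≃σ) σ∈S)
          (resp′ (subst (_≈± underlying τ) (sym (trans τ₁≡ (cong (λ v → word v (letters τ′)) tgt≡))) τ′≃τ) τ∈S)
      -- Here `ρ` is the inverse of the composite, so its left half is `τ′` inverted and its right
      -- half is `σ′` inverted.
      ∘ˢ-closed {ρ} {σ} {τ} σ∈S τ∈S (σ′ , ℓ , τ′ , σ′≃σ , τ′≃τ , end≡ , tgt≡ , inj₂ eq)
        with τ₁ , σ₁ , s , τ₁≡ , σ₁≡ ← splitAt ρ (flips (letters τ′)) (flip ℓ) (flips (letters σ′))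
               (trans (cong letters eq) (flips-++-∷ (letters σ′) ℓ (letters τ′))) =
        closed s
          (resp′ (subst (_≈± underlying τ) (sym (trans τ₁≡ (cong (λ v → word v (flips (letters τ′))) start≡)))
            (⁻¹-≈± τ τ′≃τ)) τ∈S)
          (resp′ (subst (_≈± underlying σ) (sym (trans σ₁≡ (cong (λ v → word v (flips (letters σ′)))
            (trans (tgt-flip ℓ) (sym end≡))))) (⁻¹-≈± σ σ′≃σ)) σ∈S)
        where
        start≡ : st ρ ≡ end τ′
        start≡ = trans (cong start eq) (trans (end-++-∷ (start σ′) (letters σ′) ℓ (letters τ′))
                   (cong (λ v → end (word v (letters τ′))) tgt≡))

      -- The singleton that starts the fold is generalized to any `P` inside `S`, so that the
      -- induction can follow the accumulator.
      composites⊆S : ∀ {P} → (∀ {ρ} → P ρ → S ρ) → ∀ {τs} → All S τs →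
                     ∀ {ρ} → foldl (λ P τ → P ∘ᴾ ⟨ τ ⟩) P τs ρ → S ρ
      composites⊆S P⊆S []            = P⊆S
      composites⊆S P⊆S (τ∈S ∷ τs∈S) =
        composites⊆S (λ (_ , τ′ , σ∈P , τ′≃τ , ρ∈) → ∘ˢ-closed (P⊆S σ∈P) (resp′ {τ = τ′} τ′≃τ τ∈S) ρ∈) τs∈S

    SplitClosed⇒Closed : Closed S
    SplitClosed⇒Closed =
      (λ { (σ , τs , σ∈S ∷ τs∈S , ρ∈) → composites⊆S (λ ρ≃σ → resp′ ρ≃σ σ∈S) τs∈S ρ∈ }) ,
      (λ {ρ} ρ∈S → ρ , [] , ρ∈S ∷ [] , inj₁ refl)

  -- Concatenations of pieces from `S` with one letter between consecutive pieces. Splitting off the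
  -- first piece each time gives a list-like normal form to induct on.
  data Cl (S : Pred String 0ℓ) : Pred String 0ℓ where
    base : ∀ {ρ} → S ρ → Cl S ρ
    step : ∀ {ρ σ τ} → Split ρ σ τ → S σ → Cl S τ → Cl S ρ

  Cl-splitClosed : ∀ {S} → SplitClosed (Cl S)
  Cl-splitClosed s (base σ∈S)         τ∈ = step s σ∈S τ∈
  Cl-splitClosed s (step s′ σ₁∈S σ₂∈) τ∈ =
    let υ , s₁ , s₂ = split-assocʳ s s′ in step s₁ σ₁∈S (Cl-splitClosed s₂ σ₂∈ τ∈)

  Cl-least : ∀ {S P : Pred String 0ℓ} → SplitClosed P → (∀ {σ} → S σ → P σ) → ∀ {ρ} → Cl S ρ → P ρ
  Cl-least closed S⊆P (base ρ∈S)       = S⊆P ρ∈S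
  Cl-least closed S⊆P (step s σ∈S τ∈) = closed s (S⊆P σ∈S) (Cl-least closed S⊆P τ∈)

  -- Inversion reverses the order of the pieces, so the first piece has to be appended at the end,
  -- through `Cl-splitClosed`.
  Cl-resp : ∀ {S} → (∀ {σ τ} → σ ≃ τ → S σ → S τ) → ∀ {σ τ} → σ ≃ τ → Cl S σ → Cl S τ
  Cl-resp resp ρ≃ρ′ (base ρ∈S) = base (resp ρ≃ρ′ ρ∈S)
  Cl-resp resp {ρ} {ρ′} ρ≃ρ′ (step {σ = σ} {τ} s σ∈S τ∈) with split-≃ (≃-sym ρ ρ′ ρ≃ρ′) s
  ... | σ′ , τ′ , σ′≃σ , τ′≃τ , inj₁ s′ =
    step s′ (resp (≃-sym σ′ σ σ′≃σ) σ∈S) (Cl-resp resp (≃-sym τ′ τ τ′≃τ) τ∈)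
  ... | σ′ , τ′ , σ′≃σ , τ′≃τ , inj₂ s′ =
    Cl-splitClosed s′ (Cl-resp resp (≃-sym τ′ τ τ′≃τ) τ∈) (base (resp (≃-sym σ′ σ σ′≃σ) σ∈S))

  -- No piece of a decomposition is longer than the whole, so only the part of `S` below length `n`
  -- matters.
  Cl-truncate : ∀ {S P : Pred String 0ℓ} {n} → (∀ {σ} → len σ < n → S σ → P σ) →
                ∀ {ρ} → len ρ < n → Cl S ρ → Cl P ρ
  Cl-truncate S⊆P ρ<n (base ρ∈S)       = base (S⊆P ρ<n ρ∈S)
  Cl-truncate S⊆P ρ<n (step s σ∈S τ∈) =
    step s (S⊆P (ℕ.<-trans (left-shorter s) ρ<n) σ∈S)
           (Cl-truncate S⊆P (ℕ.<-trans (right-shorter s) ρ<n) τ∈)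

  SplitCoclosed : Pred (Pred String 0ℓ) 0ℓ
  SplitCoclosed S = ∀ {ρ σ τ} → Split ρ σ τ → S ρ → S σ ⊎ S τ

  -- A cut of a concatenation either lies between two of its pieces or cuts
  -- one piece, of which one half then belongs to S.
  Cl-splitCoclosed : ∀ {S} → (∀ {σ τ} → σ ≃ τ → S σ → S τ) → SplitCoclosed S → SplitCoclosed (Cl S)
  Cl-splitCoclosed resp coclosed s (base ρ∈S) = Sum.map base base (coclosed s ρ∈S)
  Cl-splitCoclosed resp coclosed s (step s′ σ′∈S τ′∈) with compareSplits s s′
  ... | inj₁ (σ≡σ′ , _)          = inj₁ (base (resp (inj₁ (sym σ≡σ′)) σ′∈S))
  ... | inj₂ (inj₁ (υ , s₁ , s₂)) = Sum.map base (λ υ∈S → step s₂ υ∈S τ′∈) (coclosed s₁ σ′∈S)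
  ... | inj₂ (inj₂ (υ , s₁ , s₂)) =
    Sum.map₁ (step s₁ σ′∈S) (Cl-splitCoclosed resp coclosed s₂ τ′∈)

  -- Biclosed sets and their complements.

  infix 4 _∋_
  _∋_ : BiclosedSet → Pred String 0ℓ
  X ∋ σ = ⟦ BiclosedSet.stringSet X ⟧ σ

  mem : BiclosedSet → String → Bool
  mem X = member (BiclosedSet.stringSet X)

  mem-resp : ∀ X {σ τ} → σ ≃ τ → mem X σ ≡ mem X τ
  mem-resp X = member-resp (BiclosedSet.stringSet X)

  ∋-resp : ∀ X {σ τ} → σ ≃ τ → X ∋ σ → X ∋ τ
  ∋-resp X σ≃τ = subst T (mem-resp X σ≃τ)

  splitClosed : ∀ X → SplitClosed (X ∋_)
  splitClosed X = Closed⇒SplitClosed (BiclosedSet.closed X)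

  -- Coclosedness only refutes that both halves are missing; as membership is Boolean, one that is
  -- present can be found.
  splitCoclosed : ∀ X → SplitCoclosed (X ∋_)
  splitCoclosed X {ρ} {σ} {τ} s ρ∈X = decidable-stable (T? _ ⊎-dec T? _) λ σ,τ∉X →
    Closed⇒SplitClosed (BiclosedSet.coclosed X) s (σ,τ∉X ∘ inj₁) (σ,τ∉X ∘ inj₂) ρ∈X

  biclosed : (m : String → Bool) → (∀ {σ τ} → σ ≃ τ → T (m σ) → T (m τ)) →
             SplitClosed (T ∘ m) → SplitCoclosed (T ∘ m) → BiclosedSet
  biclosed m resp closed coclosed = record
    { stringSet = record
      { member      = m
      ; member-resp = λ {σ} {τ} σ≃τ → T-injective (resp σ≃τ) (resp (≃-sym σ τ σ≃τ))
      }
    ; closed    = SplitClosed⇒Closed resp closed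
    ; coclosed  = SplitClosed⇒Closed (λ {σ} {τ} σ≃τ σ∉ τ∈ → σ∉ (resp (≃-sym σ τ σ≃τ) τ∈))
                    (λ s σ∉ τ∉ ρ∈ → Sum.[ σ∉ , τ∉ ] (coclosed s ρ∈))
    }

  T-not⁺ : ∀ {b} → ¬ T b → T (not b)
  T-not⁺ {Bool.false} _  = _
  T-not⁺ {Bool.true}  ¬t = ¬t _

  T-not⁻ : ∀ {b} → T (not b) → ¬ T b
  T-not⁻ {Bool.false} _ ()

  complement : BiclosedSet → BiclosedSet
  complement X = biclosed (not ∘ mem X)
    (λ σ≃τ → subst (T ∘ not) (mem-resp X σ≃τ))
    (λ s σ∉X τ∉X → T-not⁺ λ ρ∈X → Sum.[ T-not⁻ σ∉X , T-not⁻ τ∉X ] (splitCoclosed X s ρ∈X))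
    (λ {ρ} {σ} {τ} s ρ∉X → case T? (mem X σ) of λ where
      (no σ∉X)  → inj₁ (T-not⁺ σ∉X)
      (yes σ∈X) → inj₂ (T-not⁺ λ τ∈X → T-not⁻ ρ∉X (splitClosed X s σ∈X τ∈X)))

  _⊆ᴮ_ : BiclosedSet → BiclosedSet → Set
  _⊆ᴮ_ = Poset._≤_ BiclQ

  complement-anti : ∀ X Y → X ⊆ᴮ Y → complement Y ⊆ᴮ complement X
  complement-anti X Y X⊆Y σ∉Y = T-not⁺ (T-not⁻ σ∉Y ∘ X⊆Y)

  complement-involutive : ∀ X → Poset._≈_ BiclQ (complement (complement X)) X
  complement-involutive X =
    (λ {σ} → subst T (Bool.not-involutive (mem X σ))) , (λ {σ} → subst T (sym (Bool.not-involutive (mem X σ))))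

-- The lattice of biclosed sets

module FiniteBicl (Q : BoundQuiver) (finite : Strings.FinitelyManyStrings Q) where
  open BoundQuiver Q
  open Strings Q renaming (_∘_ to _∘ᴾ_; Bicl to BiclQ) hiding (FinitelyManyStrings)
  open Splitting Q

  -- Decision procedures over the finite list of strings.

  private
    #strings : ℕ
    #strings = length (proj₁ finite)

    el : Fin #strings → String
    el = lookup (proj₁ finite)

    idx : String → Fin #strings
    idx σ = index (proj₂ finite σ)

    el-idx : ∀ σ → underlying σ ≡ underlying (el (idx σ))
    el-idx σ = Any.lookup-index (proj₂ finite σ)

    ≃-el-idx : ∀ σ → σ ≃ el (idx σ)
    ≃-el-idx σ = inj₁ (el-idx σ)

    _≟ᴸ_ : DecidableEquality (List Letter)
    _≟ᴸ_ = List.≡-dec (Product.≡-dec Fin._≟_ Sign._≟_)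

    _≟ᵂ_ : DecidableEquality Word
    word v xs ≟ᵂ word w ys = map′ (uncurry (cong₂ word)) (λ eq → cong start eq , cong letters eq)
                                  ((v Fin.≟ w) ×-dec (xs ≟ᴸ ys))

    _≃?_ : ∀ σ τ → Dec (σ ≃ τ)
    σ ≃? τ = (underlying σ ≟ᵂ underlying τ) ⊎-dec (underlying σ ≟ᵂ (underlying τ ⁻¹))

    split? : ∀ ρ σ τ → Dec (Split ρ σ τ)
    split? ρ σ τ = map′ to from ((st ρ Fin.≟ st σ) ×-dec Fin.any? λ α → at? (α , Sign.+) ⊎-dec at? (α , Sign.-))
      where
      At : Letter → Set
      At ℓ = tgt ℓ ≡ st τ × ls ρ ≡ ls σ ++ ℓ ∷ ls τ
      at? : ∀ ℓ → Dec (At ℓ)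
      at? ℓ = (tgt ℓ Fin.≟ st τ) ×-dec (ls ρ ≟ᴸ (ls σ ++ ℓ ∷ ls τ))
      to : st ρ ≡ st σ × (∃ λ α → At (α , Sign.+) ⊎ At (α , Sign.-)) → Split ρ σ τ
      to (st≡ , _ , inj₁ (p , q)) = split _ st≡ p q
      to (st≡ , _ , inj₂ (p , q)) = split _ st≡ p q
      from : Split ρ σ τ → st ρ ≡ st σ × (∃ λ α → At (α , Sign.+) ⊎ At (α , Sign.-))
      from (split (α , Sign.+) st≡ p q) = st≡ , α , inj₁ (p , q)
      from (split (α , Sign.-) st≡ p q) = st≡ , α , inj₂ (p , q)

    split-el : ∀ {ρ σ τ} → Split ρ σ τ → Split (el (idx ρ)) (el (idx σ)) (el (idx τ))
    split-el {ρ} {σ} {τ} (split ℓ p q r) = split ℓ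
      (trans (sym (cong start (el-idx ρ))) (trans p (cong start (el-idx σ))))
      (trans q (cong start (el-idx τ)))
      (trans (sym (cong letters (el-idx ρ))) (trans r
        (cong₂ (λ xs ys → xs ++ ℓ ∷ ys) (cong letters (el-idx σ)) (cong letters (el-idx τ)))))

    split-from-el : ∀ {ρ σ τ} → Split (el (idx ρ)) σ τ → Split ρ σ τ
    split-from-el {ρ} (split ℓ p q r) =
      split ℓ (trans (cong start (el-idx ρ)) p) q (trans (cong letters (el-idx ρ)) r)

    all? : {P : Pred String 0ℓ} → Unary.Decidable P → (∀ {σ τ} → underlying σ ≡ underlying τ → P σ → P τ) →
           Dec (∀ σ → P σ)
    all? P? resp = map′ (λ all σ → resp (sym (el-idx σ)) (all (idx σ))) (λ all i → all (el i))
                        (Fin.all? (P? ∘ el))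

  module _ {S : Pred String 0ℓ} (S? : Unary.Decidable S) (resp : ∀ {σ τ} → σ ≃ τ → S σ → S τ) where

    private
      -- The recursion is on a bound for the length, and pieces are sought among the listed strings
      -- only.
      Cl?-fuel : ∀ n ρ → len ρ < n → Dec (Cl S ρ)
      Cl?-fuel (suc n) ρ (s≤s ρ≤n) = map′
        Sum.[ base , (λ (_ , _ , s , σ∈S , τ∈) → step s σ∈S τ∈) ]
        (λ { (base ρ∈S) → inj₁ ρ∈S
           ; (step {σ = σ} {τ} s σ∈S τ∈) → inj₂ (idx σ , idx τ , split-from-el (split-el s) ,
               resp (≃-el-idx σ) σ∈S , Cl-resp resp (≃-el-idx τ) τ∈) })
        (S? ρ ⊎-dec Fin.any? λ i → Fin.any? λ k → step? i k)
        where
        step? : ∀ i k → Dec (Split ρ (el i) (el k) × S (el i) × Cl S (el k))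
        -- The cut is decided first because it supplies the length bound for the recursive call on
        -- the tail.
        step? i k with split? ρ (el i) (el k)
        ... | no ¬s = no (¬s ∘ proj₁)
        ... | yes s = map′ (s ,_) proj₂ (S? (el i) ×-dec Cl?-fuel n (el k) (ℕ.≤-trans (right-shorter s) ρ≤n))

    Cl? : Unary.Decidable (Cl S)
    Cl? ρ = Cl?-fuel (suc (len ρ)) ρ ℕ.≤-refl

  -- Joins and meets of biclosed sets.

  module _ (X Y : BiclosedSet) where

    ∪-resp : ∀ {σ τ} → σ ≃ τ → ((X ∋_) ∪ (Y ∋_)) σ → ((X ∋_) ∪ (Y ∋_)) τ
    ∪-resp σ≃τ = Sum.map (∋-resp X σ≃τ) (∋-resp Y σ≃τ)

    ∪-coclosed : SplitCoclosed ((X ∋_) ∪ (Y ∋_))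
    ∪-coclosed s (inj₁ ρ∈X) = Sum.map inj₁ inj₁ (splitCoclosed X s ρ∈X)
    ∪-coclosed s (inj₂ ρ∈Y) = Sum.map inj₂ inj₂ (splitCoclosed Y s ρ∈Y)

    Cl∪? : Unary.Decidable (Cl ((X ∋_) ∪ (Y ∋_)))
    Cl∪? = Cl? (λ σ → T? _ ⊎-dec T? _) ∪-resp

  infixr 6 _∨_
  infixr 7 _∧_

  _∨_ : BiclosedSet → BiclosedSet → BiclosedSet
  X ∨ Y = biclosed (λ σ → ⌊ Cl∪? X Y σ ⌋)
    (λ σ≃τ σ∈ → fromWitness (Cl-resp (∪-resp X Y) σ≃τ (toWitness σ∈)))
    (λ s σ∈ τ∈ → fromWitness (Cl-splitClosed s (toWitness σ∈) (toWitness τ∈)))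
    (λ s ρ∈ → Sum.map fromWitness fromWitness
      (Cl-splitCoclosed (∪-resp X Y) (∪-coclosed X Y) s (toWitness ρ∈)))

  ∨⁺ : ∀ X Y {σ} → Cl ((X ∋_) ∪ (Y ∋_)) σ → X ∨ Y ∋ σ
  ∨⁺ X Y = fromWitness

  ∨⁻ : ∀ X Y {σ} → X ∨ Y ∋ σ → Cl ((X ∋_) ∪ (Y ∋_)) σ
  ∨⁻ X Y = toWitness

  _∧_ : BiclosedSet → BiclosedSet → BiclosedSet
  X ∧ Y = complement (complement X ∨ complement Y)

  isLattice : IsLattice (Poset._≈_ BiclQ) _⊆ᴮ_ _∨_ _∧_
  isLattice = record
    { isPartialOrder = Poset.isPartialOrder BiclQ
    ; supremum = λ X Y → (λ {σ} → ∨⁺ X Y ∘ base ∘ inj₁) , (λ {σ} → ∨⁺ X Y ∘ base ∘ inj₂) , sup-least X Y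
    ; infimum  = λ X Y →
        (λ {σ} σ∈ → decidable-stable (T? _) λ σ∉X → T-not⁻ σ∈ (∨⁺ (complement X) (complement Y) (base (inj₁ (T-not⁺ σ∉X))))) ,
        (λ {σ} σ∈ → decidable-stable (T? _) λ σ∉Y → T-not⁻ σ∈ (∨⁺ (complement X) (complement Y) (base (inj₂ (T-not⁺ σ∉Y))))) ,
        (λ Z Z⊆X Z⊆Y {σ} σ∈Z → T-not⁺ λ σ∈ → T-not⁻ (sup-least (complement X) (complement Y) (complement Z)
          (complement-anti Z X Z⊆X) (complement-anti Z Y Z⊆Y) σ∈) σ∈Z)
    }
    where
    sup-least : ∀ X Y Z → X ⊆ᴮ Z → Y ⊆ᴮ Z → (X ∨ Y) ⊆ᴮ Z
    sup-least X Y Z X⊆Z Y⊆Z = Cl-least (splitClosed Z) Sum.[ X⊆Z , Y⊆Z ] ∘ ∨⁻ X Y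

  lattice : Lattice 0ℓ 0ℓ 0ℓ
  lattice = record { isLattice = isLattice }

  _⊆ᴮ?_ : Decidable _⊆ᴮ_
  X ⊆ᴮ? Y = map′ (λ X⊆Y {σ} → X⊆Y σ) (λ X⊆Y σ → X⊆Y)
    (all? (λ σ → T? (mem X σ) →-dec T? (mem Y σ))
          (λ σ≡τ σ⇒ → ∋-resp Y (inj₁ σ≡τ) ∘ σ⇒ ∘ ∋-resp X (inj₁ (sym σ≡τ))))

  -- Enumeration of the biclosed sets.

  private
    table : BiclosedSet → Fin #strings → Bool
    table X = mem X ∘ el

    record BiclosedTable (f : Fin #strings → Bool) : Set where
      constructor biclosedTable
      field
        resp     : ∀ i j → el i ≃ el j → T (f i) → T (f j)
        closed   : ∀ i j k → Split (el i) (el j) (el k) → T (f j) → T (f k) → T (f i)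
        coclosed : ∀ i j k → Split (el i) (el j) (el k) → T (f i) → T (f j) ⊎ T (f k)

    biclosedTable? : ∀ f → Dec (BiclosedTable f)
    biclosedTable? f = map′ (λ (r , c , d) → biclosedTable r c d) (λ (biclosedTable r c d) → r , c , d)
      ((Fin.all? λ i → Fin.all? λ j → (el i ≃? el j) →-dec (T? _ →-dec T? _)) ×-dec
       (Fin.all? λ i → Fin.all? λ j → Fin.all? λ k → split? _ _ _ →-dec (T? _ →-dec (T? _ →-dec T? _))) ×-dec
       (Fin.all? λ i → Fin.all? λ j → Fin.all? λ k → split? _ _ _ →-dec (T? _ →-dec (T? _ ⊎-dec T? _))))

    el-idx-≃ : ∀ σ τ → σ ≃ τ → el (idx σ) ≃ el (idx τ)
    el-idx-≃ σ τ = subst₂ _≈±_ (el-idx σ) (el-idx τ)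

    realizable? : ∀ f → Dec (∃ λ X → table X ≡.≗ f)
    realizable? f = map′ realize tabulated (biclosedTable? f)
      where
      realize : BiclosedTable f → ∃ λ X → table X ≡.≗ f
      realize (biclosedTable resp closed coclosed) =
        biclosed (f ∘ idx) (λ {σ} {τ} σ≃τ → resp _ _ (el-idx-≃ σ τ σ≃τ))
          (λ s → closed _ _ _ (split-el s)) (λ s → coclosed _ _ _ (split-el s)) ,
        λ i → T-injective (resp _ _ (inj₁ (sym (el-idx (el i))))) (resp _ _ (inj₁ (el-idx (el i))))
      tabulated : (∃ λ X → table X ≡.≗ f) → BiclosedTable f
      tabulated (X , X≗f) = biclosedTable
        (λ i j i≃j → to j ∘ ∋-resp X i≃j ∘ from i)
        (λ i j k s fj fk → to i (splitClosed X s (from j fj) (from k fk)))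
        (λ i j k s → Sum.map (to j) (to k) ∘ splitCoclosed X s ∘ from i)
        where
        to : ∀ i → X ∋ el i → T (f i)
        to i = subst T (X≗f i)
        from : ∀ i → T (f i) → X ∋ el i
        from i = subst T (sym (X≗f i))

    table-⊆ : ∀ X Y → table X ≡.≗ table Y → X ⊆ᴮ Y
    table-⊆ X Y X≗Y {σ} = ∋-resp Y (inj₁ (sym (el-idx σ))) ∘ subst T (X≗Y (idx σ)) ∘ ∋-resp X (≃-el-idx σ)

  biclosedSets : Σ[ Xs ∈ List BiclosedSet ] IsEnumeration (Poset.Eq.setoid BiclQ) Xs
  biclosedSets = enumerateTables table realizable? {Poset._≈_ BiclQ}
    (λ {X} {Y} X≗Y → table-⊆ X Y X≗Y , table-⊆ Y X (sym ∘ X≗Y))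

  private
    module L = FiniteLattice lattice _⊆ᴮ?_ (proj₂ biclosedSets)
    module P = FinitePoset BiclQ _⊆ᴮ?_ (proj₂ biclosedSets)
  open Irreducibles BiclQ
  open JoinIrreducible
  open Congruences lattice using (Congruence)

  -- The congruence attached to a string and a choice of halves.

  Agree : ℕ → BiclosedSet → BiclosedSet → Set
  Agree n X Y = ∀ ρ → len ρ < n → mem X ρ ≡ mem Y ρ

  Matches : String → BiclosedSet → BiclosedSet → Set
  Matches σ J X = ∀ σ₁ σ₂ → Split σ σ₁ σ₂ → mem X σ₁ ≡ mem J σ₁ × mem X σ₂ ≡ mem J σ₂

  Exact : String → BiclosedSet → Set
  Exact σ J = ∀ {σ₁ σ₂} → Split σ σ₁ σ₂ → mem J σ₁ ≡ not (mem J σ₂)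

  -- The kernel of the restriction to strings shorter than σ, refined so as to
  -- see σ itself over the biclosed sets matching J.
  Ψ : String → BiclosedSet → BiclosedSet → BiclosedSet → Set
  Ψ σ J X Y = Agree (len σ) X Y × (Matches σ J X → mem X σ ≡ mem Y σ)

  -- The halves of a cut are shorter than `σ`. This is what makes `Ψ` symmetric and transitive
  -- although it tests only its first argument for matching.
  agree⇒matches : ∀ σ {J X Y} → Agree (len σ) X Y → Matches σ J X → Matches σ J Y
  agree⇒matches σ agree matches σ₁ σ₂ s =
    let (eq₁ , eq₂) = matches _ _ s in
    trans (sym (agree _ (left-shorter s))) eq₁ , trans (sym (agree _ (right-shorter s))) eq₂

  Ψ-sym : ∀ σ J {X Y} → Ψ σ J X Y → Ψ σ J Y X
  Ψ-sym σ J {X} {Y} (agree , eq) = agree⁻ ,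
    λ matches → sym (eq (agree⇒matches σ {J} {Y} {X} agree⁻ matches))
    where
    agree⁻ : Agree (len σ) Y X
    agree⁻ ρ ρ<σ = sym (agree ρ ρ<σ)

  Ψ-trans : ∀ σ J {X Y Z} → Ψ σ J X Y → Ψ σ J Y Z → Ψ σ J X Z
  Ψ-trans σ J {X} {Y} (agree , eq) (agree′ , eq′) =
    (λ ρ ρ<σ → trans (agree ρ ρ<σ) (agree′ ρ ρ<σ)) ,
    λ matches → trans (eq matches) (eq′ (agree⇒matches σ {J} {X} {Y} agree matches))

  -- The condition on `J′` is pointwise, so that the lemma serves both for passing to `complement J`
  -- and for coming back to `J`.
  Ψ-complement : ∀ σ J J′ {X Y} → (∀ ρ → mem J′ ρ ≡ not (mem J ρ)) →
                 Ψ σ J X Y → Ψ σ J′ (complement X) (complement Y)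
  Ψ-complement σ J J′ J′≡ (agree , eq) = (λ ρ ρ<σ → cong not (agree ρ ρ<σ)) , λ matches →
    cong not (eq λ _ _ s → let (eq₁ , eq₂) = matches _ _ s in
      Bool.not-injective (trans eq₁ (J′≡ _)) , Bool.not-injective (trans eq₂ (J′≡ _)))

  -- A biclosed subset of a matching set that contains σ contains one half of
  -- each cut of σ, and it can only be the half which belongs to J.
  matches-⊆ : ∀ {σ J} X Z → Exact σ J → X ⊆ᴮ Z → Matches σ J Z → X ∋ σ → Matches σ J X
  matches-⊆ {σ} {J} X Z exact X⊆Z matches σ∈X σ₁ σ₂ s =
      T-injective X⇒J₁ (λ σ₁∈J → Sum.[ id , (λ σ₂∈X → contradiction (X⇒J₂ σ₂∈X) (J₁⇒¬J₂ σ₁∈J)) ]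
                                       (splitCoclosed X s σ∈X))
    , T-injective X⇒J₂ (λ σ₂∈J → Sum.[ (λ σ₁∈X → contradiction σ₂∈J (J₁⇒¬J₂ (X⇒J₁ σ₁∈X))) , id ]
                                       (splitCoclosed X s σ∈X))
    where
    X⇒J₁ : X ∋ σ₁ → J ∋ σ₁
    X⇒J₁ = subst T (proj₁ (matches _ _ s)) ∘ X⊆Z
    X⇒J₂ : X ∋ σ₂ → J ∋ σ₂
    X⇒J₂ = subst T (proj₂ (matches _ _ s)) ∘ X⊆Z
    J₁⇒¬J₂ : J ∋ σ₁ → ¬ J ∋ σ₂
    J₁⇒¬J₂ = T-not⁻ ∘ subst T (exact s)

  module _ σ J (exact : Exact σ J) where

    private
      ∪-agree : ∀ {n} X Y U V → Agree n X Y → Agree n U V →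
                ∀ {ρ} → len ρ < n → ((X ∋_) ∪ (U ∋_)) ρ → ((Y ∋_) ∪ (V ∋_)) ρ
      ∪-agree X Y U V X≡Y U≡V ρ<n = Sum.map (subst T (X≡Y _ ρ<n)) (subst T (U≡V _ ρ<n))

      ∨-⊆ : ∀ {n} X Y U V → Agree n X Y → Agree n U V →
            ∀ ρ → len ρ < n → X ∨ U ∋ ρ → Y ∨ V ∋ ρ
      ∨-⊆ X Y U V X≡Y U≡V ρ ρ<n = ∨⁺ Y V ∘ Cl-truncate (∪-agree X Y U V X≡Y U≡V) ρ<n ∘ ∨⁻ X U

      -- If `σ` lies in `X` or `U`, that set matches `J` by `matches-⊆`, so `Y` or `V` contains `σ`
      -- too. Otherwise `σ` is a concatenation of shorter pieces, on which the sets agree.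
      ∨-σ : ∀ X Y U V → Ψ σ J X Y → Ψ σ J U V → Matches σ J (X ∨ U) → X ∨ U ∋ σ → Y ∨ V ∋ σ
      ∨-σ X Y U V (X≡Y , X≡Yσ) (U≡V , U≡Vσ) matches = ∨⁺ Y V ∘ go ∘ ∨⁻ X U
        where
        go : Cl ((X ∋_) ∪ (U ∋_)) σ → Cl ((Y ∋_) ∪ (V ∋_)) σ
        go (base (inj₁ σ∈X)) = base (inj₁ (subst T
          (X≡Yσ (matches-⊆ {σ} {J} X (X ∨ U) exact (∨⁺ X U ∘ base ∘ inj₁) matches σ∈X)) σ∈X))
        go (base (inj₂ σ∈U)) = base (inj₂ (subst T
          (U≡Vσ (matches-⊆ {σ} {J} U (X ∨ U) exact (∨⁺ X U ∘ base ∘ inj₂) matches σ∈U)) σ∈U))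
        go (step s σ₁∈ σ₂∈) = step s (∪-agree X Y U V X≡Y U≡V (left-shorter s) σ₁∈)
          (Cl-truncate (∪-agree X Y U V X≡Y U≡V) (right-shorter s) σ₂∈)

    Ψ-∨ : ∀ X Y U V → Ψ σ J X Y → Ψ σ J U V → Ψ σ J (X ∨ U) (Y ∨ V)
    Ψ-∨ X Y U V XY@(X≡Y , _) UV@(U≡V , _) = agree , λ matches → T-injective
        (∨-σ X Y U V XY UV matches)
        (∨-σ Y X V U YX VU (agree⇒matches σ {J} {X ∨ U} {Y ∨ V} agree matches))
      where
      YX = Ψ-sym σ J {X} {Y} XY
      VU = Ψ-sym σ J {U} {V} UV
      agree : Agree (len σ) (X ∨ U) (Y ∨ V)
      agree ρ ρ<σ = T-injective (∨-⊆ X Y U V X≡Y U≡V ρ ρ<σ) (∨-⊆ Y X V U (proj₁ YX) (proj₁ VU) ρ ρ<σ)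

  private
    agree? : ∀ n X Y → Dec (Agree n X Y)
    agree? n X Y = all? (λ ρ → (len ρ ℕ.<? n) →-dec (mem X ρ Bool.≟ mem Y ρ))
      (λ {ρ} {ρ′} ρ≡ρ′ eq ρ′<n → trans (mem-resp X (inj₁ (sym ρ≡ρ′)))
        (trans (eq (subst (λ w → length (letters w) < n) (sym ρ≡ρ′) ρ′<n)) (mem-resp Y (inj₁ ρ≡ρ′))))

    matches? : ∀ σ J X → Dec (Matches σ J X)
    matches? σ J X = map′ everywhere (λ matches i j → matches (el i) (el j))
      (Fin.all? λ i → Fin.all? λ j → split? σ (el i) (el j) →-dec
        ((mem X (el i) Bool.≟ mem J (el i)) ×-dec (mem X (el j) Bool.≟ mem J (el j))))
      where
      everywhere : (∀ i j → Split σ (el i) (el j) → mem X (el i) ≡ mem J (el i) × mem X (el j) ≡ mem J (el j)) →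
                   Matches σ J X
      everywhere matches σ₁ σ₂ s =
        let (eq₁ , eq₂) = matches (idx σ₁) (idx σ₂) (split-from-el (split-el s)) in
        trans (mem-resp X (≃-el-idx σ₁)) (trans eq₁ (mem-resp J (inj₁ (sym (el-idx σ₁))))) ,
        trans (mem-resp X (≃-el-idx σ₂)) (trans eq₂ (mem-resp J (inj₁ (sym (el-idx σ₂)))))

    Ψ? : ∀ σ J X Y → Dec (Ψ σ J X Y)
    Ψ? σ J X Y = agree? (len σ) X Y ×-dec (matches? σ J X →-dec (mem X σ Bool.≟ mem Y σ))

  ψ : ∀ σ J → Exact σ J → Congruence
  ψ σ J exact = record
    { related       = λ X Y → ⌊ Ψ? σ J X Y ⌋
    ; ∼-resp-≈      = λ {X} {Y} (X⊆Y , Y⊆X) →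
        fromWitness {a? = Ψ? σ J X Y} ((λ _ _ → T-injective X⊆Y Y⊆X) , (λ _ → T-injective X⊆Y Y⊆X))
    ; isEquivalence = record
      { refl  = λ {X} → fromWitness {a? = Ψ? σ J X X} ((λ _ _ → refl) , λ _ → refl)
      ; sym   = λ {X} {Y} XY → fromWitness {a? = Ψ? σ J Y X} (Ψ-sym σ J {X} {Y} (toWitness XY))
      ; trans = λ {X} {Y} {Z} XY YZ → fromWitness {a? = Ψ? σ J X Z}
          (Ψ-trans σ J {X} {Y} {Z} (toWitness XY) (toWitness YZ))
      }
    ; ∨-cong = λ {X} {Y} {U} {V} XY UV → fromWitness {a? = Ψ? σ J (X ∨ U) (Y ∨ V)}
        (Ψ-∨ σ J exact X Y U V (toWitness XY) (toWitness UV))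
    -- Meets are complements of joins of complements, so `Ψ-∨` is applied to `J′`, which inherits
    -- exactness from `J`.
    ; ∧-cong = λ {X} {Y} {U} {V} XY UV → fromWitness {a? = Ψ? σ J (X ∧ U) (Y ∧ V)}
        (Ψ-complement σ J′ J {complement X ∨ complement U} {complement Y ∨ complement V}
          (λ ρ → sym (Bool.not-involutive (mem J ρ)))
          (Ψ-∨ σ J′ (λ s → cong not (exact s)) (complement X) (complement Y) (complement U) (complement V)
            (Ψ-complement σ J J′ {X} {Y} (λ _ → refl) (toWitness XY))
            (Ψ-complement σ J J′ {U} {V} (λ _ → refl) (toWitness UV))))
    }
    where
    J′ = complement J

  -- The field `agree` expresses that `σ` has minimal length among the strings in `j` but not in
  -- `j₋`.
  record Label (j : JoinIrreducible) : Set where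
    field
      σ     : String
      σ∈j   : element j ∋ σ
      σ∉j₋  : ¬ lower j ∋ σ
      agree : Agree (len σ) (lower j) (element j)

    -- If both halves were in `j`, they would be in `j₋`, being shorter than `σ`, and closedness
    -- would put `σ` in `j₋`. Coclosedness of `j` provides at least one half.
    exact : Exact σ (element j)
    exact s = T-injective
      (λ σ₁∈j → T-not⁺ λ σ₂∈j → σ∉j₋ (splitClosed (lower j) s
        (subst T (sym (agree _ (left-shorter s))) σ₁∈j) (subst T (sym (agree _ (right-shorter s))) σ₂∈j)))
      (λ σ₂∉j → Sum.[ id , (λ σ₂∈j → contradiction σ₂∈j (T-not⁻ σ₂∉j)) ] (splitCoclosed (element j) s σ∈j))

    -- By agreement on shorter strings `j₋` matches `j`, so the congruence sees that they differ at
    -- `σ`.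
    ψ-avoids : ¬ L.Contracts (ψ σ (element j) exact) j
    ψ-avoids jψ = σ∉j₋ (subst T (sym (proj₂ (toWitness {a? = Ψ? σ (element j) (lower j) (element j)} jψ)
      λ _ _ s → agree _ (left-shorter s) , agree _ (right-shorter s))) σ∈j)

  label : ∀ j → Label j
  label j with Fin.any? (λ i → T? (mem (element j) (el i)) ×-dec ¬? (T? (mem (lower j) (el i))))
  ... | no ∄ = contradiction
        (λ {ρ} ρ∈j → ∋-resp (lower j) (inj₁ (sym (el-idx ρ))) (decidable-stable (T? _) λ ρ∉j₋ →
          ∄ (idx ρ , ∋-resp (element j) (≃-el-idx ρ) ρ∈j , ρ∉j₋)))
        (P.≰lower j)
  ... | yes (i , i∈) with minimalIn {_≲_ = λ ρ ρ′ → len ρ ℕ.≤ len ρ′} ℕ.≤-refl ℕ.≤-trans (λ ρ ρ′ → len ρ ℕ.≤? len ρ′)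
                            (λ ρ → T? (mem (element j) ρ) ×-dec ¬? (T? (mem (lower j) ρ))) (proj₁ finite) i∈
  ... | σ , (σ∈j , σ∉j₋) , _ , min = record
    { σ = σ ; σ∈j = σ∈j ; σ∉j₋ = σ∉j₋
    ; agree = λ ρ ρ<σ → T-injective (P.lower≤ j) λ ρ∈j → decidable-stable (T? _) λ ρ∉j₋ →
        ℕ.<⇒≱ ρ<σ (All.lookupWith
          (λ {ρ′} h ρ≡ρ′ → subst (λ w → len σ ℕ.≤ length (letters w)) (sym ρ≡ρ′)
            (h (∋-resp (element j) (inj₁ ρ≡ρ′) ρ∈j , ρ∉j₋ ∘ ∋-resp (lower j) (inj₁ (sym ρ≡ρ′)))
               (subst (λ w → length (letters w) ℕ.≤ len σ) ρ≡ρ′ (ℕ.<⇒≤ ρ<σ))))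
          min (proj₂ finite ρ))
    }

  -- In a decomposition of σ, consider the first prefix ending at a cut that
  -- belongs to X; as X and Y contain the same prefixes and are coclosed, its
  -- last piece belongs to both.
  ∈-∧ : ∀ σ X Y → Matches σ X Y → X ∋ σ → Y ∋ σ → X ∧ Y ∋ σ
  ∈-∧ σ X Y matches σ∈X σ∈Y = T-not⁺ (noDecomposition ∘ ∨⁻ (complement X) (complement Y))
    where
    S : Pred String 0ℓ
    S = (complement X ∋_) ∪ (complement Y ∋_)

    ∉S : ∀ {ρ} → X ∋ ρ → Y ∋ ρ → ¬ S ρ
    ∉S ρ∈X ρ∈Y = Sum.[ (λ ρ∉X → T-not⁻ ρ∉X ρ∈X) , (λ ρ∉Y → T-not⁻ ρ∉Y ρ∈Y) ]

    rest : ∀ Z {ρ π τ} → Split ρ π τ → Z ∋ ρ → ¬ Z ∋ π → Z ∋ τ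
    rest Z s ρ∈Z π∉Z = Sum.[ (λ π∈Z → contradiction π∈Z π∉Z) , id ] (splitCoclosed Z s ρ∈Z)

    Y⇒X : ∀ {π τ} → Split σ π τ → Y ∋ π → X ∋ π
    Y⇒X s = subst T (proj₁ (matches _ _ s))

    X⇒Y : ∀ {π τ} → Split σ π τ → X ∋ π → Y ∋ π
    X⇒Y s = subst T (sym (proj₁ (matches _ _ s)))

    noSuffix : ∀ {π τ} → Split σ π τ → ¬ X ∋ π → ¬ Cl S τ
    -- No prefix ending at one of the cuts belongs to `X`; the whole of `σ` then takes the role of
    -- the first one that does.
    noSuffix s π∉X (base τ∈S) = ∉S (rest X s σ∈X π∉X) (rest Y s σ∈Y (π∉X ∘ Y⇒X s)) τ∈S
    noSuffix s π∉X (step s′ τ₁∈S τ₂∈) with υ , s₁ , s₂ ← split-assocˡ s s′ with T? (mem X υ)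
    ... | no  υ∉X = noSuffix s₁ υ∉X τ₂∈
    ... | yes υ∈X = ∉S (rest X s₂ υ∈X π∉X) (rest Y s₂ (X⇒Y s₁ υ∈X) (π∉X ∘ Y⇒X s)) τ₁∈S

    noDecomposition : ¬ Cl S σ
    noDecomposition (base σ∈S) = ∉S σ∈X σ∈Y σ∈S
    noDecomposition (step {σ = π} s π∈S τ∈) with T? (mem X π)
    ... | no  π∉X = noSuffix s π∉X τ∈
    ... | yes π∈X = ∉S π∈X (X⇒Y s π∈X) π∈S

  -- Join-irreducibles are determined by the congruences that contract them.

  separated : ∀ j k → (∀ θ → L.Contracts θ j ⇔ L.Contracts θ k) → j ≈ʲ k
  separated j k contracts =
      (λ {ρ} → x∧y≤y (element j) (element k) {ρ} ∘ above j (x∧y≤x (element j) (element k)) (Label.σ∉j₋ J))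
    , (λ {ρ} → x∧y≤x (element j) (element k) {ρ} ∘ above k (x∧y≤y (element j) (element k)) σ∉k₋)
    where
    open Lattice lattice using (x∧y≤x; x∧y≤y)
    J = label j
    K = label k
    σⱼ = Label.σ J
    σₖ = Label.σ K

    -- If `σₖ` were shorter, `j₋` and `j` would agree on it and on everything shorter. The
    -- congruence attached to `σₖ` would then contract `j`, hence `k`, against `ψ-avoids`.
    σⱼ≤σₖ : len σⱼ ℕ.≤ len σₖ
    σⱼ≤σₖ = ℕ.≮⇒≥ λ σₖ<σⱼ → Label.ψ-avoids K (Equivalence.to (contracts (ψ σₖ (element k) (Label.exact K)))
      (fromWitness {a? = Ψ? σₖ (element k) (lower j) (element j)}
        ((λ ρ ρ<σₖ → Label.agree J ρ (ℕ.<-trans ρ<σₖ σₖ<σⱼ)) , λ _ → Label.agree J σₖ σₖ<σⱼ)))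

    agreeₖ : Agree (len σⱼ) (lower k) (element k)
    agreeₖ ρ ρ<σⱼ = Label.agree K ρ (ℕ.≤-trans ρ<σⱼ σⱼ≤σₖ)

    k∉ψ : ¬ Ψ σⱼ (element j) (lower k) (element k)
    k∉ψ kψ = Label.ψ-avoids J (Equivalence.from (contracts (ψ σⱼ (element j) (Label.exact J)))
      (fromWitness {a? = Ψ? σⱼ (element j) (lower k) (element k)} kψ))

    neq : ¬ (mem (lower k) σⱼ ≡ mem (element k) σⱼ)
    neq eq = k∉ψ (agreeₖ , λ _ → eq)

    σ∈k : element k ∋ σⱼ
    σ∈k = decidable-stable (T? _) λ σ∉k →
      neq (T-injective (P.lower≤ k) (λ σ∈k → contradiction σ∈k σ∉k))

    σ∉k₋ : ¬ lower k ∋ σⱼ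
    σ∉k₋ σ∈k₋ = neq (T-injective (P.lower≤ k) (λ _ → σ∈k₋))

    -- If `lower k` did not match `j`, the condition of `Ψ` at `σⱼ` would be vacuous and `k` would
    -- be contracted. Agreement on shorter strings carries the matching over to `element k`.
    matches : Matches σⱼ (element j) (element k)
    matches = agree⇒matches σⱼ {element j} {lower k} {element k} agreeₖ
      (decidable-stable (matches? σⱼ (element j) (lower k)) λ ¬matches →
        k∉ψ (agreeₖ , λ matches → contradiction matches ¬matches))

    meet : BiclosedSet
    meet = element j ∧ element k

    -- The meet contains `σⱼ`, so it is not below `lower i`, and hence not strictly below
    -- `element i`.
    above : ∀ i → meet ⊆ᴮ element i → ¬ lower i ∋ σⱼ → element i ⊆ᴮ meet
    above i meet⊆i σ∉i₋ = decidable-stable (element i ⊆ᴮ? meet) λ i⊈meet →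
      σ∉i₋ (P.strictlyBelow⇒≤lower i {meet} meet⊆i i⊈meet
        (∈-∧ σⱼ (element j) (element k) matches (Label.σ∈j J) σ∈k))

  isCongruenceUniformLattice : IsCongruenceUniformLattice BiclQ
  isCongruenceUniformLattice = record
    { isLattice = isLattice
    ; congruenceUniform = record
      { finite            = biclosedSets
      ; join-irreducibles = L.con-bijection separated
      ; meet-irreducibles =
          SelfDual.meetBijection lattice complement (λ {X} {Y} → complement-anti X Y) complement-involutive
            (L.con-bijection separated)
      }
    }

theorem7p6 : (Q : GentleBoundQuiver) → FinitelyManyStrings Q → IsCongruenceUniformLattice (Bicl Q)
theorem7p6 Q finite = FiniteBicl.isCongruenceUniformLattice (GentleBoundQuiver.boundQuiver Q) finite
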